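{- There is a constant $c>0$ and a family of triangle-free critical graphs which, for every $k\geq 4$, contains infinitely many $k$-chromatic graphs, each member on $n$ vertices having more than $cn^2$ edges. In particular, the density constants satisfy $c_{3,4}\geq \frac{1}{16}$, $c_{3,5}\geq \frac{4}{31}$, and $c_{3,k}=\frac14$ for all $k\geq 6$.
   Context: A graph is $k$-critical if it has chromatic number $k$ and removing any edge allows it to be properly $(k-1)$-colored; a graph is critical if it is $k$-critical for some $k$. The odd-girth of a graph is the length of a shortest odd cycle (so "odd-girth $>3$" means triangle-free). For integers $\ell\geq 3$, $k\geq 4$, the density constant $c_{\ell,k}$ is the supremum of the constants $c$ such that there are infinitely many $k$-critical graphs of odd-girth $>\ell$, each having more than $cn^2$ edges, where $n$ is its number of vertices. -}

module Defs where

open import Level using (Level; 0ℓ; _⊔_) renaming (suc to lsuc)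
open import Data.Nat using (ℕ; suc; pred; _*_; _≤_; _<_)
open import Data.Nat.Divisibility using (_∣_)
open import Data.Nat.DivMod using (_mod_)
open import Data.Integer using (+_)
open import Data.Rational as ℚ using (ℚ)
open import Data.Fin using (Fin; toℕ)
open import Data.Fin.Properties using (nonZeroIndex; _≟_; _<?_)
open import Data.List using (length; filter; allFin; cartesianProduct)
open import Data.Product using (_×_; _,_; Σ-syntax; ∃-syntax; swap; uncurry)
open import Data.Sum as Sum using (_⊎_)
open import Function.Base using (_∘_)
open import Function.Bundles using (_↔_; _⇔_; Inverse)
open import Function.Definitions using (Injective)
open import Relation.Binary.Core using (Rel)
open import Relation.Binary.Definitions using (Symmetric; Decidable)
open import Relation.Binary.PropositionalEquality using (_≡_; _≢_)
open import Relation.Nullary using (¬_; ¬?)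
open import Relation.Nullary.Decidable using (_×-dec_; _⊎-dec_)
open import Relation.Unary using (Pred; _∈_)

private
  variable
    a : Level

record Graph : Set₁ where
  infix 4 _~_ _~?_
  field
    order    : ℕ
    _~_      : Rel (Fin order) 0ℓ
    _~?_     : Decidable _~_
    ~-sym    : Symmetric _~_
    ~-irrefl : ∀ {x} → ¬ (x ~ x)

  Vertex : Set
  Vertex = Fin order

  -- Each undirected edge is counted once, at its endpoints in increasing order.
  size : ℕ
  size = length (filter (uncurry λ x y → (x <? y) ×-dec (x ~? y))
                        (cartesianProduct (allFin order) (allFin order)))

open Graph using (order; size; Vertex)

infix 4 _≅_
record _≅_ (G H : Graph) : Set where
  private
    module G = Graph G
    module H = Graph H
  field
    vertices : Vertex G ↔ Vertex H
    adjacent : ∀ x y → (x G.~ y) ⇔ (Inverse.to vertices x H.~ Inverse.to vertices y)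

InfinitelyMany : Pred Graph a → Set (lsuc 0ℓ ⊔ a)
InfinitelyMany P =
  Σ[ G ∈ (ℕ → Graph) ] (∀ i → G i ∈ P) × (∀ {i j} → G i ≅ G j → i ≡ j)

SameEnds : ∀ {n} → Fin n → Fin n → Rel (Fin n) 0ℓ
SameEnds u v x y = (x ≡ u × y ≡ v) ⊎ (x ≡ v × y ≡ u)

deleteEdge : (G : Graph) → Vertex G → Vertex G → Graph
deleteEdge G u v = record
  { order    = order G
  ; _~_      = λ x y → (x ~ y) × ¬ SameEnds u v x y
  ; _~?_     = λ x y → (x ~? y) ×-dec
                 ¬? (((x ≟ u) ×-dec (y ≟ v)) ⊎-dec ((x ≟ v) ×-dec (y ≟ u)))
  ; ~-sym    = λ (x~y , xy≢uv) → ~-sym x~y , xy≢uv ∘ Sum.map swap swap ∘ Sum.swap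
  ; ~-irrefl = λ (x~x , _) → ~-irrefl x~x
  }
  where open Graph G using (_~_; _~?_; ~-sym; ~-irrefl)

Colorable : Graph → ℕ → Set
Colorable G k =
  Σ[ f ∈ (Vertex G → Fin k) ] (∀ {x y} → x ~ y → f x ≢ f y)
  where open Graph G using (_~_)

HasChromaticNumber : Graph → ℕ → Set
HasChromaticNumber G k = Colorable G k × (∀ j → Colorable G j → k ≤ j)

-- When k = 0 the graph has no vertices, so the value of pred 0 is irrelevant.
IsCritical : ℕ → Pred Graph 0ℓ
IsCritical k G =
  HasChromaticNumber G k ×
  (∀ u v → u ~ v → Colorable (deleteEdge G u v) (pred k))
  where open Graph G using (_~_)

Critical : Pred Graph 0ℓ
Critical G = ∃[ k ] IsCritical k G

cyclicSuc : ∀ {m} → Fin m → Fin m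
cyclicSuc {m} i = (suc (toℕ i) mod m) {{nonZeroIndex i}}

record Cycle (G : Graph) (m : ℕ) : Set where
  open Graph G using (_~_)
  field
    long     : 3 ≤ m
    vertex   : Fin m → Vertex G
    distinct : Injective _≡_ _≡_ vertex
    adjacent : ∀ i → vertex i ~ vertex (cyclicSuc i)

-- Bipartite graphs, which have no odd cycle, have infinite odd-girth.
OddGirth> : ℕ → Pred Graph 0ℓ
OddGirth> ℓ G = ∀ m → ¬ (2 ∣ m) → Cycle G m → ℓ < m

TriangleFree : Pred Graph 0ℓ
TriangleFree G = ¬ Cycle G 3

HasDensity> : ℚ → Pred Graph 0ℓ
HasDensity> c G = c ℚ.* (+ (order G * order G) ℚ./ 1) ℚ.< (+ size G ℚ./ 1)

-- The constants whose supremum is the density constant c_{ℓ,k}.  Restricting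
-- them to rationals does not change the supremum: the set of real constants
-- with this property is closed downwards.
DensityConstants : ℕ → ℕ → Pred ℚ (lsuc 0ℓ)
DensityConstants ℓ k c =
  InfinitelyMany λ G → IsCritical k G × OddGirth> ℓ G × HasDensity> c G

-- The real number sup S is compared with a rational r through the elements
-- of S, since sup S itself need not be rational.
Sup≥ : Pred ℚ a → ℚ → Set a
Sup≥ S r = ∀ q → q ℚ.< r → ∃[ s ] s ∈ S × q ℚ.< s

Sup≤ : Pred ℚ a → ℚ → Set a
Sup≤ S r = ∀ s → s ∈ S → s ℚ.≤ r

IsSup : Pred ℚ a → ℚ → Set a
IsSup S r = Sup≤ S r × Sup≥ S r

{-# OPTIONS --safe #-}

-- Zykov's construction turns triangle-free critical graphs A₁, …, Aⱼ of
-- chromatic numbers o + 1, …, o + j into a graph with an independent set of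
-- ∏ |Aᵢ| hubs, on which every colouring with o + j colours uses more than j.
-- Two such graphs with o + j = o′ + j′ = j + j′ + 1, completely joined along
-- their hubs as in Toft's graph, are therefore not (j + j′ + 1)-colourable, and
-- criticality of the Aᵢ passes to the result.  If j, j′ ≥ 2, almost all
-- vertices are hubs and almost half of them can be put on each side: density
-- 1/4 for k = j + j′ + 2 ≥ 6.  For j = j′ = 1 one gets Toft's 4-critical graphs
-- of density 1/16 from odd cycles, and for j = 2, j′ = 1 density 4/31 by matching
-- the hubs of one side with such a graph.

module Submission where

open import Defs
open import Level using (0ℓ)
open import Data.Empty using (⊥; ⊥-elim)
open import Data.Fin as Fin using (Fin; zero; suc; toℕ; punchIn; punchOut; inject≤)
import Data.Fin.Properties as Finₚ
open import Data.Integer as ℤ using (+_)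
import Data.Integer.Properties as ℤₚ
import Data.Integer.Solver as ℤSolver
open import Data.List using (List; []; _∷_; length; filter; allFin; cartesianProduct; lookup)
open import Data.List.Extrema.Nat using (argmax; f[xs]≤f[argmax])
import Data.List.Membership.Propositional as List
open import Data.List.Membership.Propositional.Properties
  using (∈-lookup; ∈-filter⁺; ∈-filter⁻; ∈-cartesianProduct⁺; ∈-allFin)
open import Data.List.Properties using (length-tabulate)
open import Data.List.Relation.Unary.AllPairs using (_∷_)
import Data.List.Relation.Unary.All as All
import Data.List.Relation.Unary.Any as Any
import Data.List.Relation.Unary.Any.Properties as Anyₚ
open import Data.List.Relation.Unary.Unique.Propositional using (Unique)
import Data.List.Relation.Unary.Unique.Propositional.Properties as Uniqueₚ
open import Data.Nat as ℕ using (ℕ; zero; suc; _+_; _*_; _≤_; _<_; z≤n; s≤s)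
open import Data.Nat.Divisibility using (_∣_; divides)
open import Data.Nat.Induction using (<-rec)
import Data.Nat.Properties as ℕₚ
open import Data.Nat.Solver using (module +-*-Solver)
open import Data.Product as Product using (_×_; _,_; Σ-syntax; ∃-syntax; proj₁; proj₂; uncurry)
open import Data.Product.Function.NonDependent.Propositional using (_×-↔_)
import Data.Product.Properties as Productₚ
open import Data.Rational as ℚ using (ℚ; 0ℚ; ↥_; ↧_; ↧ₙ_; mkℚ; _/_)
import Data.Rational.Properties as ℚₚ
import Data.Rational.Unnormalised as ℚᵘ
import Data.Rational.Unnormalised.Properties as ℚᵘₚ
open import Data.Sum as Sum using (_⊎_; inj₁; inj₂; [_,_]′)
open import Data.Sum.Function.Propositional using (_⊎-↔_)
import Data.Sum.Properties as Sumₚ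
open import Data.Unit using (⊤; tt)
open import Function.Base using (_∘_; id; case_of_)
open import Function.Bundles using (_↔_; _⇔_; Equivalence; Inverse; mk⇔)
open import Function.Definitions using (Injective)
open import Function.Properties.Inverse using (↔-refl; ↔-sym; ↔-trans)
open import Relation.Binary.Core using (Rel)
open import Relation.Binary.Definitions
  using (Symmetric; Decidable; DecidableEquality; tri<; tri≈; tri>)
open import Relation.Binary.PropositionalEquality
  using (_≡_; _≢_; refl; sym; trans; cong; cong₂; subst; subst₂; ≢-sym)
open import Relation.Nullary using (¬_; Dec; yes; no; contradiction; ¬?)
open import Relation.Nullary.Decidable using (_×-dec_; _⊎-dec_; from-yes)
open import Relation.Unary as U using (Pred; _∈_)

open Graph using (order; size; Vertex)

-- "More than `j` colours on the hubs" is stated as follows: however `j` of the colours are singled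
-- out, some hub has none of these. This form supports induction along the chain, because a colour
-- seen at the head can move to the other class for the rest. Criticality needs the bound to be
-- sharp everywhere: any prescribed hub can be made the only exception, and deleting any edge of a
-- side removes the need for an exception. Two such colourings, with disjoint sets of singled-out
-- colours on the two sides, can clash only at the exceptional hubs. The obstacle to density 1/4 is
-- arithmetic. The two hub sets are products of different numbers of orders and must have almost
-- equal size, while the constructions control orders only up to arithmetic progressions. One factor
-- is therefore shared, and the remaining variable factors are taken from the same progression, so
-- that the discrepancy does not grow with its parameter.

Joins : ∀ {V : Set} → V → V → Rel V 0ℓ
Joins u v x y = (x ≡ u × y ≡ v) ⊎ (x ≡ v × y ≡ u)

Joins-map : ∀ {V W : Set} {f : V → W} {u v x y} → Joins u v x y → Joins (f u) (f v) (f x) (f y)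
Joins-map {f = f} = Sum.map both both
  where both : ∀ {a b c d} → a ≡ b × c ≡ d → f a ≡ f b × f c ≡ f d
        both (p , q) = cong f p , cong f q

-- Triangle-free critical graphs

inhabited : ∀ G {o} → ¬ Colorable G o → Vertex G
inhabited G uncol with Finₚ.any? {n = order G} (λ v → v Finₚ.≟ v)
... | yes (v , _) = v
... | no none     = ⊥-elim (uncol ((λ v → ⊥-elim (none (v , refl))) , λ {x} → ⊥-elim (none (x , refl))))

NoTriangle : Graph → Set
NoTriangle G = ∀ {x y z} → x ~ y → y ~ z → ¬ (z ~ x)
  where open Graph G using (_~_)

-- Only the edge `ab` can be monochromatic, so a new colour for `a` repairs the colouring and leaves
-- `a` alone in its class.
isolate : ∀ {o} (G : Graph) (a b : Vertex G) → Colorable (deleteEdge G a b) o →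
          Σ[ f ∈ (Vertex G → Fin (suc o)) ] (∀ {x y} → Graph._~_ G x y → f x ≢ f y)
          × f a ≡ zero × (∀ x → x ≢ a → ∃[ i ] f x ≡ suc i)
isolate {o} G a b (g , g-proper) = f , proper , at-a , elsewhere
  where
  open Graph G using (_~_; ~-irrefl)

  f : Vertex G → Fin (suc o)
  f x with x Finₚ.≟ a
  ... | yes _ = zero
  ... | no  _ = suc (g x)

  proper : ∀ {x y} → x ~ y → f x ≢ f y
  proper {x} {y} x~y with x Finₚ.≟ a | y Finₚ.≟ a
  ... | yes refl | yes refl = λ _ → ~-irrefl x~y
  ... | yes _    | no _     = λ ()
  ... | no _     | yes _    = λ ()
  ... | no x≢a   | no y≢a   =
    g-proper (x~y , λ { (inj₁ (x≡a , _)) → x≢a x≡a ; (inj₂ (_ , y≡a)) → y≢a y≡a }) ∘ Finₚ.suc-injective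

  at-a : f a ≡ zero
  at-a with a Finₚ.≟ a
  ... | yes _  = refl
  ... | no a≢a = contradiction refl a≢a

  elsewhere : ∀ x → x ≢ a → ∃[ i ] f x ≡ suc i
  elsewhere x x≢a with x Finₚ.≟ a
  ... | yes x≡a = contradiction x≡a x≢a
  ... | no  _   = g x , refl

Joins-sym : ∀ {V : Set} {u v : V} → Symmetric (Joins u v)
Joins-sym (inj₁ (p , q)) = inj₂ (q , p)
Joins-sym (inj₂ (p , q)) = inj₁ (q , p)

-- The index is one less than the chromatic number: it is the number of colours that just fails. A
-- neighbour for every vertex provides an edge to delete there, so that any vertex can be made alone
-- in its colour class.
record Crit (o : ℕ) : Set₁ where
  field
    graph       : Graph
    critical    : IsCritical (suc o) graph
    neighbour   : ∀ v → ∃[ w ] Graph._~_ graph v w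
    no-triangle : NoTriangle graph

  open Graph graph public using (_~_; _~?_; ~-sym; ~-irrefl)

  V : Set
  V = Vertex graph

  ∣V∣ : ℕ
  ∣V∣ = order graph

  uncolourable : ¬ Colorable graph o
  uncolourable c = ℕₚ.<-irrefl refl (proj₂ (proj₁ critical) o c)

  edge-deleted : ∀ u v → u ~ v →
                 Σ[ f ∈ (V → Fin o) ] (∀ {x y} → x ~ y → ¬ SameEnds u v x y → f x ≢ f y)
  edge-deleted u v u~v with proj₂ critical u v u~v
  ... | f , proper = f , λ x~y ≢uv → proper (x~y , ≢uv)

  point : V
  point = inhabited graph uncolourable

  only-at : ∀ a → Σ[ f ∈ (V → Fin (suc o)) ] (∀ {x y} → x ~ y → f x ≢ f y)
                  × f a ≡ zero × (∀ x → x ≢ a → ∃[ i ] f x ≡ suc i)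
  only-at a = let b , a~b = neighbour a in isolate graph a b (proj₂ critical a b a~b)

-- Deleting an edge saves at most one colour, so the upper bound on the chromatic number follows
-- from one deletion. An edge exists because a graph that is not `o`-colourable has a vertex, which
-- has a neighbour.
crit : ∀ {o} (G : Graph) → ¬ Colorable G o →
       (∀ u v → Graph._~_ G u v → Colorable (deleteEdge G u v) o) →
       (∀ v → ∃[ w ] Graph._~_ G v w) → NoTriangle G → Crit o
crit {o} G uncol del nbr tf = record
  { graph = G
  ; critical = (colourable , minimal) , del
  ; neighbour = nbr
  ; no-triangle = tf
  }
  where
  a = inhabited G uncol
  coloured = let b , a~b = nbr a in isolate G a b (del a b a~b)

  colourable : Colorable G (suc o)
  colourable = proj₁ coloured , proj₁ (proj₂ coloured)

  minimal : ∀ j → Colorable G j → suc o ≤ j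
  minimal j (f , proper) with suc o ℕ.≤? j
  ... | yes o<j = o<j
  ... | no o≮j  = ⊥-elim (uncol ((λ x → inject≤ (f x) j≤o) ,
                    λ x~y eq → proper x~y (Finₚ.inject≤-injective j≤o j≤o _ _ eq)))
    where j≤o = ℕₚ.≤-pred (ℕₚ.≰⇒> o≮j)

open Crit using (graph; ∣V∣)

-- Zykov's construction: one critical graph of each chromatic number
-- o + 1, …, o + j, together with an independent set of hubs, one hub for each
-- transversal and adjacent to its members.
data Chain : ℕ → ℕ → Set₁ where
  []  : ∀ {o} → Chain o 0
  _∷_ : ∀ {o j} → Crit o → Chain (suc o) j → Chain o (suc j)

infixr 5 _∷_

private
  variable
    o j j′ : ℕ

Base : Chain o j → Set
Base []       = ⊥
Base (A ∷ As) = Crit.V A ⊎ Base As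

Hub : Chain o j → Set
Hub []       = ⊤
Hub (A ∷ As) = Crit.V A × Hub As

∣Base∣ : Chain o j → ℕ
∣Base∣ []       = 0
∣Base∣ (A ∷ As) = ∣V∣ A + ∣Base∣ As

∣Hub∣ : Chain o j → ℕ
∣Hub∣ []       = 1
∣Hub∣ (A ∷ As) = ∣V∣ A * ∣Hub∣ As

Base↔Fin : (As : Chain o j) → Base As ↔ Fin (∣Base∣ As)
Base↔Fin []       = ↔-sym Finₚ.0↔⊥
Base↔Fin (A ∷ As) = ↔-trans (↔-refl ⊎-↔ Base↔Fin As) (↔-sym Finₚ.+↔⊎)

Hub↔Fin : (As : Chain o j) → Hub As ↔ Fin (∣Hub∣ As)
Hub↔Fin []       = ↔-sym Finₚ.1↔⊤
Hub↔Fin (A ∷ As) = ↔-trans (↔-refl ×-↔ Hub↔Fin As) (↔-sym Finₚ.*↔×)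

_≟ₕ_ : {As : Chain o j} → DecidableEquality (Hub As)
_≟ₕ_ {As = []}     tt tt = yes refl
_≟ₕ_ {As = A ∷ As} = Productₚ.≡-dec Finₚ._≟_ (_≟ₕ_ {As = As})

hub : (As : Chain o j) → Hub As
hub []       = tt
hub (A ∷ As) = Crit.point A , hub As

_∣_~ᵇ_ : (As : Chain o j) → Rel (Base As) 0ℓ
(A ∷ As) ∣ inj₁ x ~ᵇ inj₁ y = Crit._~_ A x y
(A ∷ As) ∣ inj₂ x ~ᵇ inj₂ y = As ∣ x ~ᵇ y
(A ∷ As) ∣ _      ~ᵇ _      = ⊥

_∣_∈ʰ_ : (As : Chain o j) → Base As → Hub As → Set
(A ∷ As) ∣ inj₁ x ∈ʰ (a , t) = x ≡ a
(A ∷ As) ∣ inj₂ x ∈ʰ (a , t) = As ∣ x ∈ʰ t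

~ᵇ-dec : (As : Chain o j) → Decidable (As ∣_~ᵇ_)
~ᵇ-dec (A ∷ As) (inj₁ x) (inj₁ y) = Crit._~?_ A x y
~ᵇ-dec (A ∷ As) (inj₁ x) (inj₂ y) = no λ ()
~ᵇ-dec (A ∷ As) (inj₂ x) (inj₁ y) = no λ ()
~ᵇ-dec (A ∷ As) (inj₂ x) (inj₂ y) = ~ᵇ-dec As x y

∈ʰ-dec : (As : Chain o j) → ∀ x t → Dec (As ∣ x ∈ʰ t)
∈ʰ-dec (A ∷ As) (inj₁ x) (a , t) = x Finₚ.≟ a
∈ʰ-dec (A ∷ As) (inj₂ x) (a , t) = ∈ʰ-dec As x t

~ᵇ-sym : (As : Chain o j) → Symmetric (As ∣_~ᵇ_)
~ᵇ-sym (A ∷ As) {inj₁ x} {inj₁ y} = Crit.~-sym A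
~ᵇ-sym (A ∷ As) {inj₂ x} {inj₂ y} = ~ᵇ-sym As

~ᵇ-irrefl : (As : Chain o j) → ∀ {x} → ¬ (As ∣ x ~ᵇ x)
~ᵇ-irrefl (A ∷ As) {inj₁ x} = Crit.~-irrefl A
~ᵇ-irrefl (A ∷ As) {inj₂ x} = ~ᵇ-irrefl As

~ᵇ-neighbour : (As : Chain o j) → ∀ x → ∃[ y ] (As ∣ x ~ᵇ y)
~ᵇ-neighbour (A ∷ As) (inj₁ x) = let y , x~y = Crit.neighbour A x in inj₁ y , x~y
~ᵇ-neighbour (A ∷ As) (inj₂ x) = let y , x~y = ~ᵇ-neighbour As x in inj₂ y , x~y

~ᵇ-no-triangle : (As : Chain o j) → ∀ {x y z} →
                 As ∣ x ~ᵇ y → As ∣ y ~ᵇ z → ¬ (As ∣ z ~ᵇ x)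
~ᵇ-no-triangle (A ∷ As) {inj₁ _} {inj₁ _} {inj₁ _} = Crit.no-triangle A
~ᵇ-no-triangle (A ∷ As) {inj₂ _} {inj₂ _} {inj₂ _} = ~ᵇ-no-triangle As

∈ʰ-independent : (As : Chain o j) → ∀ {x y t} → As ∣ x ∈ʰ t → As ∣ y ∈ʰ t → ¬ (As ∣ x ~ᵇ y)
∈ʰ-independent (A ∷ As) {inj₁ _} {inj₁ _} refl refl = Crit.~-irrefl A
∈ʰ-independent (A ∷ As) {inj₂ _} {inj₂ _} = ∈ʰ-independent As

Side : Chain o j → Set
Side As = Base As ⊎ Hub As

_∣_~ˢ_ : (As : Chain o j) → Rel (Side As) 0ℓ
As ∣ inj₁ x ~ˢ inj₁ y = As ∣ x ~ᵇ y
As ∣ inj₁ x ~ˢ inj₂ t = As ∣ x ∈ʰ t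
As ∣ inj₂ t ~ˢ inj₁ x = As ∣ x ∈ʰ t
As ∣ inj₂ _ ~ˢ inj₂ _ = ⊥

~ˢ-dec : (As : Chain o j) → Decidable (As ∣_~ˢ_)
~ˢ-dec As (inj₁ x) (inj₁ y) = ~ᵇ-dec As x y
~ˢ-dec As (inj₁ x) (inj₂ t) = ∈ʰ-dec As x t
~ˢ-dec As (inj₂ t) (inj₁ x) = ∈ʰ-dec As x t
~ˢ-dec As (inj₂ _) (inj₂ _) = no λ ()

~ˢ-sym : (As : Chain o j) → Symmetric (As ∣_~ˢ_)
~ˢ-sym As {inj₁ x} {inj₁ y} = ~ᵇ-sym As
~ˢ-sym As {inj₁ x} {inj₂ t} = id
~ˢ-sym As {inj₂ t} {inj₁ x} = id

~ˢ-irrefl : (As : Chain o j) → ∀ {x} → ¬ (As ∣ x ~ˢ x)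
~ˢ-irrefl As {inj₁ x} = ~ᵇ-irrefl As

~ˢ-no-triangle : (As : Chain o j) → ∀ {x y z} →
                 As ∣ x ~ˢ y → As ∣ y ~ˢ z → ¬ (As ∣ z ~ˢ x)
~ˢ-no-triangle As {inj₁ _} {inj₁ _} {inj₁ _} xy yz zx = ~ᵇ-no-triangle As xy yz zx
~ˢ-no-triangle As {inj₂ _} {inj₁ _} {inj₁ _} xy yz zx = ∈ʰ-independent As xy zx yz
~ˢ-no-triangle As {inj₁ _} {inj₂ _} {inj₁ _} xy yz zx = ∈ʰ-independent As yz xy zx
~ˢ-no-triangle As {inj₁ _} {inj₁ _} {inj₂ _} xy yz zx = ∈ʰ-independent As zx yz xy

-- Colourings of one side

-- First-class colours inj₁ and second-class colours inj₂: every proper colouring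
-- gives some hub a first-class colour, but after deleting an edge none needs one.
Palette : ℕ → ℕ → Set
Palette o j = Fin o ⊎ Fin j

ProperExcept : (As : Chain o j) → Rel (Side As) 0ℓ → (Side As → Palette o j) → Set
ProperExcept As E c = ∀ {x y} → As ∣ x ~ˢ y → ¬ E x y → c x ≢ c y

Proper : (As : Chain o j) → (Side As → Palette o j) → Set
Proper As c = ∀ {x y} → As ∣ x ~ˢ y → c x ≢ c y

ProperBase : {K : Set} (As : Chain o j) → (Base As → K) → Set
ProperBase As f = ∀ {x y} → As ∣ x ~ᵇ y → f x ≢ f y

-- If the head of the chain sees the second-class colour s, then s becomes
-- first-class for the rest of the chain.
promote : Fin (suc j) → Palette o (suc j) → Palette (suc o) j
promote s (inj₁ i) = inj₁ (suc i)
promote s (inj₂ r) with s Finₚ.≟ r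
... | yes _  = inj₁ zero
... | no s≢r = inj₂ (punchOut s≢r)

promote-injective : ∀ (s : Fin (suc j)) {a b : Palette o (suc j)} → promote s a ≡ promote s b → a ≡ b
promote-injective s {inj₁ _} {inj₁ _} refl = refl
promote-injective s {inj₁ _} {inj₂ r} eq with s Finₚ.≟ r | eq
... | yes _ | ()
... | no _  | ()
promote-injective s {inj₂ r} {inj₁ _} eq with s Finₚ.≟ r | eq
... | yes _ | ()
... | no _  | ()
promote-injective s {inj₂ r} {inj₂ r′} eq with s Finₚ.≟ r | s Finₚ.≟ r′
... | yes refl | yes refl = refl
... | no s≢r   | no s≢r′  = cong inj₂ (Finₚ.punchOut-injective s≢r s≢r′ (Sumₚ.inj₂-injective eq))
... | yes _    | no _     = case eq of λ ()
... | no _     | yes _    = case eq of λ ()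

promote-first : ∀ (s : Fin (suc j)) (a : Palette o (suc j)) {i} →
                promote s a ≡ inj₁ i → a ≡ inj₂ s ⊎ (∃[ i′ ] a ≡ inj₁ i′)
promote-first s (inj₁ i) eq = inj₂ (i , refl)
promote-first s (inj₂ r) eq with s Finₚ.≟ r
... | yes refl = inj₁ refl
... | no _     = case eq of λ ()

SecondClass : ∀ {m n} → Palette m n → Set
SecondClass c = ∃[ s ] c ≡ inj₂ s

second-class? : ∀ {m n} (c : Palette m n) → Dec (SecondClass c)
second-class? (inj₁ _) = no λ ()
second-class? (inj₂ s) = yes (s , refl)

second-class-at : (A : Crit o) (f : Crit.V A → Palette o j) → (∀ {x y} → Crit._~_ A x y → f x ≢ f y) →
                  ∃[ a ] ∃[ s ] f a ≡ inj₂ s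
second-class-at {o} A f proper with Finₚ.any? (second-class? ∘ f)
... | yes found = found
... | no none   = ⊥-elim (Crit.uncolourable A (g , g-proper))
  where
  first : ∀ a → ∃[ i ] f a ≡ inj₁ i
  first a with f a in eq
  ... | inj₁ i = i , refl
  ... | inj₂ s = contradiction (a , s , eq) none

  g : Crit.V A → Fin o
  g = proj₁ ∘ first

  g-proper : ∀ {x y} → Crit._~_ A x y → g x ≢ g y
  g-proper x~y eq = proper x~y
    (trans (proj₂ (first _)) (trans (cong inj₁ eq) (sym (proj₂ (first _)))))

-- The `o` first-class colours do not suffice for the head, so some vertex `a` of it has a
-- second-class colour `s`. All hubs through `a` avoid `s`; hence a hub through `a` that is
-- first-class after the promotion of `s` was first-class before.
hits : (As : Chain o j) (f : Base As → Palette o j) (h : Hub As → Palette o j) →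
       ProperBase As f → (∀ {x t} → As ∣ x ∈ʰ t → f x ≢ h t) → ∃[ t ] ∃[ i ] h t ≡ inj₁ i
hits [] f h _ _ with h tt in eq
... | inj₁ i = tt , i , eq
hits (A ∷ As) f h proper sees with second-class-at A (f ∘ inj₁) proper
... | a , s , fa≡s with hits As (promote s ∘ f ∘ inj₂) (promote s ∘ h ∘ (a ,_))
                         (λ x~y → proper x~y ∘ promote-injective s)
                         (λ x∈t → sees x∈t ∘ promote-injective s)
... | t , _ , eq with promote-first s (h (a , t)) eq
... | inj₁ h≡s    = contradiction (trans fa≡s (sym h≡s)) (sees refl)
... | inj₂ (i , h≡i) = (a , t) , i , h≡i

private
  _≟ₚ_ : ∀ {m n} → DecidableEquality (Palette m n)
  _≟ₚ_ = Sumₚ.≡-dec Finₚ._≟_ Finₚ._≟_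

-- A hub has one neighbour in each of the `j` graphs, too few to see `suc j` distinct colours. Each
-- step of the induction discards one colour: the one seen at the head or, if there is none, the
-- first.
free-colour : {K : Set} → DecidableEquality K → (As : Chain o j) (f : Base As → K)
              (e : Fin (suc j) → K) → Injective _≡_ _≡_ e →
              ∀ t → ∃[ s ] (∀ {x} → As ∣ x ∈ʰ t → f x ≢ e s)
free-colour _≟_ [] f e e-inj t = zero , λ { {()} }
free-colour _≟_ (A ∷ As) f e e-inj (a , t) with Finₚ.any? (λ s → f (inj₁ a) ≟ e s)
... | yes (s₀ , fa≡s₀) =
  let s , free = free-colour _≟_ As (f ∘ inj₂) (e ∘ punchIn s₀) (Finₚ.punchIn-injective s₀ _ _ ∘ e-inj) t in
  punchIn s₀ s , λ
    { {inj₁ x} refl eq → Finₚ.punchInᵢ≢i s₀ s (e-inj (trans (sym eq) fa≡s₀))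
    ; {inj₂ x} x∈t     → free x∈t }
... | no none =
  let s , free = free-colour _≟_ As (f ∘ inj₂) (e ∘ suc) (Finₚ.suc-injective ∘ e-inj) t in
  suc s , λ { {inj₁ x} refl eq → none (suc s , eq) ; {inj₂ x} x∈t → free x∈t }

-- The inverse of `promote zero`, for building colourings from the rest of the chain up to the head.
demote : Palette (suc o) j → Palette o (suc j)
demote (inj₁ zero)    = inj₂ zero
demote (inj₁ (suc i)) = inj₁ i
demote (inj₂ s)       = inj₂ (suc s)

demote-injective : ∀ {a b : Palette (suc o) j} → demote a ≡ demote b → a ≡ b
demote-injective {a = inj₁ zero}    {inj₁ zero}    refl = refl
demote-injective {a = inj₁ (suc _)} {inj₁ (suc _)} refl = refl
demote-injective {a = inj₂ _}       {inj₂ _}       refl = refl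
demote-injective {a = inj₁ zero}    {inj₁ (suc _)} ()
demote-injective {a = inj₁ zero}    {inj₂ _}       ()
demote-injective {a = inj₁ (suc _)} {inj₁ zero}    ()
demote-injective {a = inj₁ (suc _)} {inj₂ _}       ()
demote-injective {a = inj₂ _}       {inj₁ zero}    ()
demote-injective {a = inj₂ _}       {inj₁ (suc _)} ()

Free : (As : Chain o j) → (Base As → Palette o j) → Hub As → Set
Free As f t = ∃[ s ] (∀ {x} → As ∣ x ∈ʰ t → f x ≢ inj₂ s)

-- By the choice of the colouring, t sees every second-class colour exactly once,
-- while every other hub misses one.
only-blocked-at : (As : Chain o j) (t : Hub As) → Σ[ f ∈ (Base As → Palette o j) ]
  ProperBase As f
  × (∀ t′ → t′ ≢ t → Free As f t′)
  × (∀ {x} → As ∣ x ∈ʰ t → ∃[ s ] (f x ≡ inj₂ s × (∀ {y} → As ∣ y ∈ʰ t → y ≢ x → f y ≢ inj₂ s)))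
only-blocked-at [] tt = (λ ()) , (λ { {()} }) , (λ t′ t′≢t → contradiction refl t′≢t) , λ { {()} }
only-blocked-at {o} {suc j} (A ∷ As) (a , t) = f , (λ {x} {y} → proper {x} {y}) , free , blocked
  where
  p = proj₁ (Crit.only-at A a)
  p-proper = proj₁ (proj₂ (Crit.only-at A a))
  p-at = proj₁ (proj₂ (proj₂ (Crit.only-at A a)))
  p-off = proj₂ (proj₂ (proj₂ (Crit.only-at A a)))
  g = proj₁ (only-blocked-at As t)
  g-proper = proj₁ (proj₂ (only-blocked-at As t))
  g-free = proj₁ (proj₂ (proj₂ (only-blocked-at As t)))
  g-blocked = proj₂ (proj₂ (proj₂ (only-blocked-at As t)))

  f : Base (A ∷ As) → Palette o (suc j)
  f (inj₁ x) = demote (inj₁ (p x))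
  f (inj₂ x) = demote (g x)

  fa : f (inj₁ a) ≡ inj₂ zero
  fa rewrite p-at = refl

  proper : ProperBase (A ∷ As) f
  proper {inj₁ _} {inj₁ _} x~y = p-proper x~y ∘ Sumₚ.inj₁-injective ∘ demote-injective
  proper {inj₂ _} {inj₂ _} x~y = g-proper x~y ∘ demote-injective

  free : ∀ t′ → t′ ≢ (a , t) → Free (A ∷ As) f t′
  free (a′ , t′) ≢t with a′ Finₚ.≟ a
  ... | yes refl = let s , r = g-free t′ (≢t ∘ cong (a ,_)) in
    suc s , λ { {inj₁ _} refl eq → case trans (sym fa) eq of λ ()
              ; {inj₂ _} x∈t → r x∈t ∘ demote-injective }
  -- At `a′` the hub sees a first-class colour, so its `j` remaining neighbours cannot exhaust the
  -- `suc j` second-class ones.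
  ... | no a′≢a  =
    let s , r = free-colour _≟ₚ_ As (f ∘ inj₂) inj₂ Sumₚ.inj₂-injective t′
        i , eq = p-off a′ a′≢a in
    s , λ { {inj₁ _} refl fx≡s → case trans (sym (cong (λ c → demote (inj₁ c)) eq)) fx≡s of λ ()
          ; {inj₂ _} → r }

  blocked : ∀ {x} → (A ∷ As) ∣ x ∈ʰ (a , t) →
            ∃[ s ] (f x ≡ inj₂ s × (∀ {y} → (A ∷ As) ∣ y ∈ʰ (a , t) → y ≢ x → f y ≢ inj₂ s))
  blocked {inj₁ _} refl = zero , fa , λ
    { {inj₁ _} refl y≢x _ → y≢x refl
    ; {inj₂ y} y∈t _ eq → case trans (sym (cong demote (proj₁ (proj₂ (g-blocked y∈t))))) eq of λ () }
  blocked {inj₂ x} x∈t = let s , gx≡s , others = g-blocked x∈t in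
    suc s , cong demote gx≡s , λ
    { {inj₁ _} refl _ eq → case trans (sym fa) eq of λ ()
    ; {inj₂ y} y∈t y≢x eq → others y∈t (y≢x ∘ cong inj₂) (demote-injective eq) }

-- Without one of its edges the head needs first-class colours only, and the other `j` neighbours of
-- a hub leave one of `suc j` second-class colours free. For an edge further down, the head uses no
-- second-class colour but the newly demoted one, so the colours left free by induction stay free.
base-edge-deleted : (As : Chain o j) → ∀ u v → As ∣ u ~ᵇ v → Σ[ f ∈ (Base As → Palette o j) ]
  (∀ {x y} → As ∣ x ~ᵇ y → ¬ Joins u v x y → f x ≢ f y) × (∀ t → Free As f t)
base-edge-deleted {o} {suc j} (A ∷ As) (inj₁ u) (inj₁ v) u~v = f , proper , free
  where
  p = proj₁ (Crit.edge-deleted A u v u~v)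
  p-proper = proj₂ (Crit.edge-deleted A u v u~v)
  g = proj₁ (only-blocked-at As (hub As))
  g-proper = proj₁ (proj₂ (only-blocked-at As (hub As)))

  f : Base (A ∷ As) → Palette o (suc j)
  f (inj₁ x) = inj₁ (p x)
  f (inj₂ x) = demote (g x)

  proper : ∀ {x y} → (A ∷ As) ∣ x ~ᵇ y → ¬ Joins (inj₁ u) (inj₁ v) x y → f x ≢ f y
  proper {inj₁ _} {inj₁ _} x~y ≢uv = p-proper x~y (≢uv ∘ Joins-map) ∘ Sumₚ.inj₁-injective
  proper {inj₂ _} {inj₂ _} x~y ≢uv = g-proper x~y ∘ demote-injective

  free : ∀ t → Free (A ∷ As) f t
  free (a , t) = let s , r = free-colour _≟ₚ_ As (f ∘ inj₂) inj₂ Sumₚ.inj₂-injective t in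
    s , λ { {inj₁ _} _ () ; {inj₂ _} → r }
base-edge-deleted {o} {suc j} (A ∷ As) (inj₂ u) (inj₂ v) u~v = f , proper , free
  where
  p = proj₁ (Crit.only-at A (Crit.point A))
  p-proper = proj₁ (proj₂ (Crit.only-at A (Crit.point A)))
  g = proj₁ (base-edge-deleted As u v u~v)
  g-proper = proj₁ (proj₂ (base-edge-deleted As u v u~v))
  g-free = proj₂ (proj₂ (base-edge-deleted As u v u~v))

  f : Base (A ∷ As) → Palette o (suc j)
  f (inj₁ x) = demote (inj₁ (p x))
  f (inj₂ x) = demote (g x)

  proper : ∀ {x y} → (A ∷ As) ∣ x ~ᵇ y → ¬ Joins (inj₂ u) (inj₂ v) x y → f x ≢ f y
  proper {inj₁ _} {inj₁ _} x~y _ = p-proper x~y ∘ Sumₚ.inj₁-injective ∘ demote-injective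
  proper {inj₂ _} {inj₂ _} x~y ≢uv = g-proper x~y (≢uv ∘ Joins-map) ∘ demote-injective

  free : ∀ t → Free (A ∷ As) f t
  free (a , t) = let s , r = g-free t in
    suc s , λ { {inj₁ x} _ eq → case demote-injective {a = inj₁ (p x)} {b = inj₂ s} eq of λ ()
              ; {inj₂ _} x∈t → r x∈t ∘ demote-injective }

-- For an edge between `u` and the hub `v`, the base is coloured so that only `v` is blocked. The
-- colour of `u` occurs at no other neighbour of `v`, so `v` may take it once the edge is gone.
side-edge-deleted : (As : Chain o j) → ∀ u v → As ∣ u ~ˢ v → Σ[ c ∈ (Side As → Palette o j) ]
  ProperExcept As (Joins u v) c × (∀ t → SecondClass (c (inj₂ t)))
side-edge-deleted As (inj₁ u) (inj₁ v) u~v = c , proper , λ t → _ , refl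
  where
  f = proj₁ (base-edge-deleted As u v u~v)
  f-proper = proj₁ (proj₂ (base-edge-deleted As u v u~v))
  free = proj₂ (proj₂ (base-edge-deleted As u v u~v))

  c : Side As → Palette _ _
  c (inj₁ x) = f x
  c (inj₂ t) = inj₂ (proj₁ (free t))

  proper : ProperExcept As (Joins (inj₁ u) (inj₁ v)) c
  proper {inj₁ _} {inj₁ _} x~y ≢uv = f-proper x~y (≢uv ∘ Joins-map)
  proper {inj₁ _} {inj₂ t} x∈t _   = proj₂ (free t) x∈t
  proper {inj₂ t} {inj₁ _} x∈t _   = ≢-sym (proj₂ (free t) x∈t)
side-edge-deleted {o} {j} As (inj₁ u) (inj₂ v) u∈v = c , proper , second
  where
  f = proj₁ (only-blocked-at As v)
  f-proper = proj₁ (proj₂ (only-blocked-at As v))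
  free = proj₁ (proj₂ (proj₂ (only-blocked-at As v)))
  at-v = proj₂ (proj₂ (proj₂ (only-blocked-at As v))) u∈v

  h : Hub As → Fin j
  h t with _≟ₕ_ {As = As} t v
  ... | yes _  = proj₁ at-v
  ... | no t≢v = proj₁ (free t t≢v)

  c : Side As → Palette o j
  c (inj₁ x) = f x
  c (inj₂ t) = inj₂ (h t)

  sees : ∀ x t → As ∣ x ∈ʰ t → ¬ (x ≡ u × t ≡ v) → f x ≢ inj₂ (h t)
  sees x t x∈t ≢uv with _≟ₕ_ {As = As} t v
  ... | yes refl = proj₂ (proj₂ at-v) x∈t (λ x≡u → ≢uv (x≡u , refl))
  ... | no t≢v   = proj₂ (free t t≢v) x∈t

  proper : ProperExcept As (Joins (inj₁ u) (inj₂ v)) c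
  proper {inj₁ _} {inj₁ _} x~y _   = f-proper x~y
  proper {inj₁ x} {inj₂ t} x∈t ≢uv = sees x t x∈t λ { (refl , refl) → ≢uv (inj₁ (refl , refl)) }
  proper {inj₂ t} {inj₁ x} x∈t ≢uv =
    ≢-sym (sees x t x∈t λ { (refl , refl) → ≢uv (inj₂ (refl , refl)) })

  second : ∀ t → SecondClass (c (inj₂ t))
  second t = h t , refl
side-edge-deleted As (inj₂ u) (inj₁ v) v∈u =
  let c , proper , second = side-edge-deleted As (inj₁ v) (inj₂ u) v∈u in
  c , (λ x~y ≢uv → proper x~y (≢uv ∘ Sum.swap)) , second

-- When the base blocks only `t`, all neighbours of `t` are second-class, which leaves `inj₁ zero`
-- available.
only-first-class-at : (As : Chain (suc o) j) (t : Hub As) → Σ[ c ∈ (Side As → Palette (suc o) j) ]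
  Proper As c × c (inj₂ t) ≡ inj₁ zero × (∀ t′ → t′ ≢ t → SecondClass (c (inj₂ t′)))
only-first-class-at {o} {j} As t = c , (λ {x} {y} → proper {x} {y}) , at-t , second
  where
  f = proj₁ (only-blocked-at As t)
  f-proper = proj₁ (proj₂ (only-blocked-at As t))
  free = proj₁ (proj₂ (proj₂ (only-blocked-at As t)))
  blocked = proj₂ (proj₂ (proj₂ (only-blocked-at As t)))

  h : Hub As → Palette (suc o) j
  h t′ with _≟ₕ_ {As = As} t′ t
  ... | yes _   = inj₁ zero
  ... | no t′≢t = inj₂ (proj₁ (free t′ t′≢t))

  c : Side As → Palette (suc o) j
  c (inj₁ x) = f x
  c (inj₂ t) = h t

  sees : ∀ x t′ → As ∣ x ∈ʰ t′ → f x ≢ h t′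
  sees x t′ x∈t′ with _≟ₕ_ {As = As} t′ t
  ... | yes refl = λ eq → case trans (sym (proj₁ (proj₂ (blocked x∈t′)))) eq of λ ()
  ... | no t′≢t  = proj₂ (free t′ t′≢t) x∈t′

  proper : Proper As c
  proper {inj₁ _} {inj₁ _} x~y = f-proper x~y
  proper {inj₁ x} {inj₂ t} x∈t = sees x t x∈t
  proper {inj₂ t} {inj₁ x} x∈t = ≢-sym (sees x t x∈t)

  at-t : h t ≡ inj₁ zero
  at-t with _≟ₕ_ {As = As} t t
  ... | yes _  = refl
  ... | no t≢t = contradiction refl t≢t

  second : ∀ t′ → t′ ≢ t → SecondClass (h t′)
  second t′ t′≢t with _≟ₕ_ {As = As} t′ t
  ... | yes t′≡t = contradiction t′≡t t′≢t
  ... | no t′≢t  = _ , refl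

-- Graphs on enumerated vertex sets

module FiniteGraph {W : Set} {n : ℕ} (enum : W ↔ Fin n) (_~_ : Rel W 0ℓ)
  (~-dec : Decidable _~_) (~-sym : Symmetric _~_) (~-irrefl : ∀ {x} → ¬ (x ~ x)) where

  open Inverse enum using (to; from) public

  from∘to : ∀ x → from (to x) ≡ x
  from∘to = Inverse.strictlyInverseʳ enum

  from-injective : ∀ {x y} → from x ≡ from y → x ≡ y
  from-injective eq = trans (sym (Inverse.strictlyInverseˡ enum _))
                     (trans (cong to eq) (Inverse.strictlyInverseˡ enum _))

  finiteGraph : Graph
  finiteGraph = record
    { order    = n
    ; _~_      = λ x y → from x ~ from y
    ; _~?_     = λ x y → ~-dec (from x) (from y)
    ; ~-sym    = ~-sym
    ; ~-irrefl = ~-irrefl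
    }

  edge : ∀ {x y} → x ~ y → from (to x) ~ from (to y)
  edge = subst₂ _~_ (sym (from∘to _)) (sym (from∘to _))

  finiteCrit : ∀ {o} → (∀ f → ¬ (∀ {x y} → x ~ y → f x ≢ f y)) →
    (∀ u v → u ~ v → Σ[ f ∈ (W → Fin o) ] (∀ {x y} → x ~ y → ¬ Joins u v x y → f x ≢ f y)) →
    (∀ v → ∃[ w ] v ~ w) → (∀ {x y z} → x ~ y → y ~ z → ¬ (z ~ x)) → Crit o
  finiteCrit uncol del nbr tf = crit finiteGraph
    (λ (f , proper) → uncol (f ∘ to) (proper ∘ edge))
    (λ u v u~v → let f , proper = del (from u) (from v) u~v in
      f ∘ from , λ (x~y , ≢uv) → proper x~y (≢uv ∘ unmap))
    (λ v → let w , v~w = nbr (from v) in to w , subst (from v ~_) (sym (from∘to w)) v~w)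
    tf
    where
    unmap : ∀ {u v x y} → Joins (from u) (from v) (from x) (from y) → SameEnds u v x y
    unmap = Sum.map both both
      where both : ∀ {a b c d} → from a ≡ from b × from c ≡ from d → a ≡ b × c ≡ d
            both (p , q) = from-injective p , from-injective q

-- Sharing the colours between two sides

extend₁ : ∀ {n a b} → (Fin n → Palette a b) → Fin (suc n) → Palette (suc a) b
extend₁ c zero    = inj₁ zero
extend₁ c (suc k) = Sum.map₁ suc (c k)

extend₂ : ∀ {n a b} → (Fin n → Palette a b) → Fin (suc n) → Palette a (suc b)
extend₂ c zero    = inj₂ zero
extend₂ c (suc k) = Sum.map₂ suc (c k)

extend₁-injective : ∀ {n a b} {c : Fin n → Palette a b} → Injective _≡_ _≡_ c → Injective _≡_ _≡_ (extend₁ c)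
extend₁-injective inj {zero} {zero} eq = refl
extend₁-injective {c = c} inj {zero} {suc l} eq with c l | eq
... | inj₁ _ | ()
... | inj₂ _ | ()
extend₁-injective {c = c} inj {suc k} {zero} eq with c k | eq
... | inj₁ _ | ()
... | inj₂ _ | ()
extend₁-injective {c = c} inj {suc k} {suc l} eq with c k in ck | c l in cl | eq
... | inj₁ _ | inj₁ _ | refl = cong suc (inj (trans ck (sym cl)))
... | inj₂ _ | inj₂ _ | refl = cong suc (inj (trans ck (sym cl)))

extend₂-injective : ∀ {n a b} {c : Fin n → Palette a b} → Injective _≡_ _≡_ c → Injective _≡_ _≡_ (extend₂ c)
extend₂-injective inj {zero} {zero} eq = refl
extend₂-injective {c = c} inj {zero} {suc l} eq with c l | eq
... | inj₁ _ | ()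
... | inj₂ _ | ()
extend₂-injective {c = c} inj {suc k} {zero} eq with c k | eq
... | inj₁ _ | ()
... | inj₂ _ | ()
extend₂-injective {c = c} inj {suc k} {suc l} eq with c k in ck | c l in cl | eq
... | inj₁ _ | inj₁ _ | refl = cong suc (inj (trans ck (sym cl)))
... | inj₂ _ | inj₂ _ | refl = cong suc (inj (trans ck (sym cl)))

SecondOn : ∀ {n a b} → Pred (Fin n) 0ℓ → (Fin n → Palette a b) → Set
SecondOn P c = ∀ k → P k → SecondClass (c k)

-- Expresses that at most `b` colours satisfy `P`, by a renaming of the colours to which `hits`
-- applies.
Ranking : ∀ n (a b : ℕ) → Pred (Fin n) 0ℓ → Set
Ranking n a b P = Σ[ c ∈ (Fin n → Palette a b) ] Injective _≡_ _≡_ c × SecondOn P c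

-- The end of the count in `rank`: one of the two budgets is exhausted, and the other has room for
-- all remaining colours.
all-but-first : ∀ {n b P} → n ≤ b → ¬ P zero → Ranking (suc n) 1 b P
all-but-first {n} {b} {P} n≤b ¬P0 = c , inj , second
  where
  c : Fin (suc n) → Palette 1 b
  c zero    = inj₁ zero
  c (suc k) = inj₂ (inject≤ k n≤b)

  inj : Injective _≡_ _≡_ c
  inj {zero}  {zero}  _  = refl
  inj {suc k} {suc l} eq = cong suc (Finₚ.inject≤-injective n≤b n≤b k l (Sumₚ.inj₂-injective eq))

  second : SecondOn P c
  second zero    P0 = contradiction P0 ¬P0
  second (suc k) _  = _ , refl

add-first : ∀ {n a b P} → ¬ P zero → Ranking n a b (P ∘ suc) → Ranking (suc n) (suc a) b P
add-first ¬P0 (c , inj , second) = extend₁ c , extend₁-injective inj , λ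
  { zero    P0 → contradiction P0 ¬P0
  ; (suc k) Pk → let s , eq = second k Pk in s , cong (Sum.map₁ suc) eq }

add-second : ∀ {n a b P} → Ranking n a b (P ∘ suc) → Ranking (suc n) a (suc b) P
add-second (c , inj , second) = extend₂ c , extend₂-injective inj , λ
  { zero    P0 → zero , refl
  ; (suc k) Pk → let s , eq = second k Pk in suc s , cong (Sum.map₂ suc) eq }

-- Either at most j colours satisfy P or at most j′ do not.
rank : ∀ n j j′ {P : Pred (Fin n) 0ℓ} → (∀ k → Dec (P k)) → n ≤ suc (j + j′) →
       Ranking n (suc j′) j P ⊎ Ranking n (suc j) j′ (¬_ ∘ P)
rank zero    _       _        _  _      = inj₁ ((λ ()) , (λ { {()} }) , λ ())
rank (suc n) j       j′       P? 1+n≤   with P? zero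
rank (suc n) zero    j′       P? 1+n≤ | yes P0 = inj₂ (all-but-first (ℕₚ.≤-pred 1+n≤) (λ ¬P0 → ¬P0 P0))
rank (suc n) (suc j) j′       P? 1+n≤ | yes P0 =
  Sum.map add-second (add-first (λ ¬P0 → ¬P0 P0)) (rank n j j′ (P? ∘ suc) (ℕₚ.≤-pred 1+n≤))
rank (suc n) j       zero     P? 1+n≤ | no ¬P0 =
  inj₁ (all-but-first (ℕₚ.≤-trans (ℕₚ.≤-pred 1+n≤) (ℕₚ.≤-reflexive (ℕₚ.+-identityʳ j))) ¬P0)
rank (suc n) j       (suc j′) P? 1+n≤ | no ¬P0 =
  Sum.map (add-first ¬P0) add-second (rank n j j′ (P? ∘ suc)
    (ℕₚ.≤-trans (ℕₚ.≤-pred 1+n≤) (ℕₚ.≤-reflexive (ℕₚ.+-suc j j′))))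

-- Under `merge₁` and `merge₂` the second class of either side becomes the first class of the other
-- without `zero`, and `zero` is first-class on both sides. Second-class hubs of different sides
-- therefore never clash.
merge₁ : Palette (suc j′) j → Fin (suc (j + j′))
merge₁ (inj₁ zero)             = zero
merge₁ {j = j} (inj₁ (suc i))  = suc (j Fin.↑ʳ i)
merge₁ {j′ = j′} (inj₂ s)      = suc (s Fin.↑ˡ j′)

merge₂ : Palette (suc j) j′ → Fin (suc (j + j′))
merge₂ (inj₁ zero)             = zero
merge₂ {j′ = j′} (inj₁ (suc s)) = suc (s Fin.↑ˡ j′)
merge₂ {j = j} (inj₂ i)         = suc (j Fin.↑ʳ i)

↑ˡ≢↑ʳ : (s : Fin j) (i : Fin j′) → s Fin.↑ˡ j′ ≢ j Fin.↑ʳ i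
↑ˡ≢↑ʳ {j} {j′} s i eq = case trans (sym (Finₚ.splitAt-↑ˡ j s j′))
  (trans (cong (Fin.splitAt j) eq) (Finₚ.splitAt-↑ʳ j j′ i)) of λ ()

merge₁-injective : ∀ {a b : Palette (suc j′) j} → merge₁ a ≡ merge₁ b → a ≡ b
merge₁-injective {a = inj₁ zero}    {inj₁ zero}    _  = refl
merge₁-injective {j = j} {a = inj₁ (suc _)} {inj₁ (suc _)} eq =
  cong (inj₁ ∘ suc) (Finₚ.↑ʳ-injective j _ _ (Finₚ.suc-injective eq))
merge₁-injective {j′ = j′} {a = inj₂ _} {inj₂ _} eq =
  cong inj₂ (Finₚ.↑ˡ-injective j′ _ _ (Finₚ.suc-injective eq))
merge₁-injective {a = inj₁ (suc _)} {inj₂ _}       eq = contradiction (sym (Finₚ.suc-injective eq)) (↑ˡ≢↑ʳ _ _)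
merge₁-injective {a = inj₂ _}       {inj₁ (suc _)} eq = contradiction (Finₚ.suc-injective eq) (↑ˡ≢↑ʳ _ _)

merge₂-injective : ∀ {a b : Palette (suc j) j′} → merge₂ a ≡ merge₂ b → a ≡ b
merge₂-injective {a = inj₁ zero}    {inj₁ zero}    _  = refl
merge₂-injective {j′ = j′} {a = inj₁ (suc _)} {inj₁ (suc _)} eq =
  cong (inj₁ ∘ suc) (Finₚ.↑ˡ-injective j′ _ _ (Finₚ.suc-injective eq))
merge₂-injective {j = j} {a = inj₂ _} {inj₂ _} eq =
  cong inj₂ (Finₚ.↑ʳ-injective j _ _ (Finₚ.suc-injective eq))
merge₂-injective {a = inj₁ (suc _)} {inj₂ _}       eq = contradiction (Finₚ.suc-injective eq) (↑ˡ≢↑ʳ _ _)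
merge₂-injective {a = inj₂ _}       {inj₁ (suc _)} eq = contradiction (sym (Finₚ.suc-injective eq)) (↑ˡ≢↑ʳ _ _)

second≢second : ∀ {a : Palette (suc j′) j} {b : Palette (suc j) j′} →
                SecondClass a → SecondClass b → merge₁ a ≢ merge₂ b
second≢second (_ , refl) (_ , refl) = ↑ˡ≢↑ʳ _ _ ∘ Finₚ.suc-injective

first≢second : ∀ {a : Palette (suc j′) j} {b : Palette (suc j) j′} →
               a ≡ inj₁ zero → SecondClass b → merge₁ a ≢ merge₂ b
first≢second refl (_ , refl) ()

second≢first : ∀ {a : Palette (suc j′) j} {b : Palette (suc j) j′} →
               SecondClass a → b ≡ inj₁ zero → merge₁ a ≢ merge₂ b
second≢first (_ , refl) refl ()

-- The join of two sides along their hubs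

-- With j + j′ + 1 colours, the hubs of As use more than j colours and those of
-- Cs more than j′, so some colour occurs on both.
module Toft (As : Chain (suc j′) j) (Cs : Chain (suc j) j′) where

  W : Set
  W = Side As ⊎ Side Cs

  IsHub : ∀ {m n} {Bs : Chain m n} → Side Bs → Set
  IsHub (inj₁ _) = ⊥
  IsHub (inj₂ _) = ⊤

  isHub? : ∀ {m n} {Bs : Chain m n} (u : Side Bs) → Dec (IsHub {Bs = Bs} u)
  isHub? (inj₁ _) = no λ ()
  isHub? (inj₂ _) = yes tt

  _~_ : Rel W 0ℓ
  inj₁ u ~ inj₁ v = As ∣ u ~ˢ v
  inj₂ u ~ inj₂ v = Cs ∣ u ~ˢ v
  inj₁ u ~ inj₂ v = IsHub {Bs = As} u × IsHub {Bs = Cs} v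
  inj₂ v ~ inj₁ u = IsHub {Bs = As} u × IsHub {Bs = Cs} v

  ~-dec : Decidable _~_
  ~-dec (inj₁ u) (inj₁ v) = ~ˢ-dec As u v
  ~-dec (inj₂ u) (inj₂ v) = ~ˢ-dec Cs u v
  ~-dec (inj₁ u) (inj₂ v) = isHub? {Bs = As} u ×-dec isHub? {Bs = Cs} v
  ~-dec (inj₂ v) (inj₁ u) = isHub? {Bs = As} u ×-dec isHub? {Bs = Cs} v

  ~-sym : Symmetric _~_
  ~-sym {inj₁ u} {inj₁ v} = ~ˢ-sym As {u} {v}
  ~-sym {inj₂ u} {inj₂ v} = ~ˢ-sym Cs {u} {v}
  ~-sym {inj₁ u} {inj₂ v} = id
  ~-sym {inj₂ v} {inj₁ u} = id

  ~-irrefl : ∀ {x} → ¬ (x ~ x)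
  ~-irrefl {inj₁ u} = ~ˢ-irrefl As {u}
  ~-irrefl {inj₂ u} = ~ˢ-irrefl Cs {u}

  hubs-independent : ∀ {m n} (Bs : Chain m n) {u v} → IsHub {Bs = Bs} u → IsHub {Bs = Bs} v → ¬ (Bs ∣ u ~ˢ v)
  hubs-independent Bs {inj₂ _} {inj₂ _} _ _ ()

  no-triangle : ∀ {x y z} → x ~ y → y ~ z → ¬ (z ~ x)
  no-triangle {inj₁ x} {inj₁ y} {inj₁ z} xy yz zx = ~ˢ-no-triangle As {x} {y} {z} xy yz zx
  no-triangle {inj₁ _} {inj₁ _} {inj₂ _} xy (hy , _) (hx , _) = hubs-independent As hx hy xy
  no-triangle {inj₁ _} {inj₂ _} {inj₁ _} (hx , _) (hz , _) zx = hubs-independent As hz hx zx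
  no-triangle {inj₂ _} {inj₁ _} {inj₁ _} (hy , _) yz (hz , _) = hubs-independent As hy hz yz
  no-triangle {inj₁ _} {inj₂ _} {inj₂ _} (_ , hy) yz (_ , hz) = hubs-independent Cs hy hz yz
  no-triangle {inj₂ _} {inj₁ _} {inj₂ _} (_ , hx) (_ , hz) zx = hubs-independent Cs hz hx zx
  no-triangle {inj₂ _} {inj₂ _} {inj₁ _} xy (_ , hy) (_ , hx) = hubs-independent Cs hx hy xy
  no-triangle {inj₂ x} {inj₂ y} {inj₂ z} xy yz zx = ~ˢ-no-triangle Cs {x} {y} {z} xy yz zx

  neighbour : ∀ v → ∃[ w ] v ~ w
  neighbour (inj₁ (inj₁ x)) = let y , x~y = ~ᵇ-neighbour As x in inj₁ (inj₁ y) , x~y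
  neighbour (inj₁ (inj₂ _)) = inj₂ (inj₂ (hub Cs)) , _
  neighbour (inj₂ (inj₁ x)) = let y , x~y = ~ᵇ-neighbour Cs x in inj₂ (inj₁ y) , x~y
  neighbour (inj₂ (inj₂ _)) = inj₁ (inj₂ (hub As)) , _

  -- If the colours on the hubs of `As` fit into the second class, `hits` is contradicted on `As`.
  -- Otherwise the colours missing there fit into the second class; by the complete join the hubs of
  -- `Cs` have only such colours, and `hits` is contradicted on `Cs`.
  uncolourable : (f : W → Fin (suc (j + j′))) → ¬ (∀ {x y} → x ~ y → f x ≢ f y)
  uncolourable f proper with rank _ j j′ used? ℕₚ.≤-refl
    where
    used? : ∀ k → Dec (∃[ i ] f (inj₁ (inj₂ (Inverse.from (Hub↔Fin As) i))) ≡ k)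
    used? k = Finₚ.any? λ i → f _ Finₚ.≟ k
  ... | inj₁ (c , inj , second) = case trans (sym ct≡i) (proj₂ (second _ used)) of λ ()
    where
    hit = hits As (c ∘ f ∘ inj₁ ∘ inj₁) (c ∘ f ∘ inj₁ ∘ inj₂)
      (λ x~y → proper {inj₁ (inj₁ _)} {inj₁ (inj₁ _)} x~y ∘ inj)
      (λ x∈t → proper {inj₁ (inj₁ _)} {inj₁ (inj₂ _)} x∈t ∘ inj)
    t = proj₁ hit
    ct≡i = proj₂ (proj₂ hit)
    used : ∃[ i ] f (inj₁ (inj₂ (Inverse.from (Hub↔Fin As) i))) ≡ f (inj₁ (inj₂ t))
    used = Inverse.to (Hub↔Fin As) t , cong (f ∘ inj₁ ∘ inj₂) (Inverse.strictlyInverseʳ (Hub↔Fin As) t)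
  ... | inj₂ (c , inj , second) = case trans (sym ct≡i) (proj₂ (second _ unused)) of λ ()
    where
    hit = hits Cs (c ∘ f ∘ inj₂ ∘ inj₁) (c ∘ f ∘ inj₂ ∘ inj₂)
      (λ x~y → proper {inj₂ (inj₁ _)} {inj₂ (inj₁ _)} x~y ∘ inj)
      (λ x∈t → proper {inj₂ (inj₁ _)} {inj₂ (inj₂ _)} x∈t ∘ inj)
    t = proj₁ hit
    ct≡i = proj₂ (proj₂ hit)
    unused : ¬ (∃[ i ] f (inj₁ (inj₂ (Inverse.from (Hub↔Fin As) i))) ≡ f (inj₂ (inj₂ t)))
    unused (i , eq) = proper {inj₁ (inj₂ _)} {inj₂ (inj₂ _)} _ eq

  -- Between the sides only hubs are adjacent, so `apart` is the sole condition across the join. `E`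
  -- stands for the deleted edge.
  assemble : (E : Rel W 0ℓ) → Symmetric E →
    (c₁ : Side As → Palette (suc j′) j) → ProperExcept As (λ x y → E (inj₁ x) (inj₁ y)) c₁ →
    (c₂ : Side Cs → Palette (suc j) j′) → ProperExcept Cs (λ x y → E (inj₂ x) (inj₂ y)) c₂ →
    (∀ s t → ¬ E (inj₁ (inj₂ s)) (inj₂ (inj₂ t)) → merge₁ (c₁ (inj₂ s)) ≢ merge₂ (c₂ (inj₂ t))) →
    Σ[ f ∈ (W → Fin (suc (j + j′))) ] (∀ {x y} → x ~ y → ¬ E x y → f x ≢ f y)
  assemble E E-sym c₁ proper₁ c₂ proper₂ apart = f , λ {x} {y} → proper {x} {y}
    where
    f : W → Fin (suc (j + j′))
    f (inj₁ u) = merge₁ (c₁ u)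
    f (inj₂ v) = merge₂ (c₂ v)

    proper : ∀ {x y} → x ~ y → ¬ E x y → f x ≢ f y
    proper {inj₁ _} {inj₁ _} x~y ¬E = proper₁ x~y ¬E ∘ merge₁-injective
    proper {inj₂ _} {inj₂ _} x~y ¬E = proper₂ x~y ¬E ∘ merge₂-injective
    proper {inj₁ (inj₂ s)} {inj₂ (inj₂ t)} _ ¬E = apart s t ¬E
    proper {inj₂ (inj₂ t)} {inj₁ (inj₂ s)} _ ¬E = ≢-sym (apart s t (¬E ∘ E-sym))

  -- The shared colour `zero` occurs on the hubs `s` and `t` and on no others, so the deleted edge
  -- is the only clash.
  hub-edge-deleted : ∀ s t → Σ[ f ∈ (W → Fin (suc (j + j′))) ]
    (∀ {x y} → x ~ y → ¬ Joins (inj₁ (inj₂ s)) (inj₂ (inj₂ t)) x y → f x ≢ f y)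
  hub-edge-deleted s t with only-first-class-at As s | only-first-class-at Cs t
  ... | c₁ , proper₁ , at-s , second₁ | c₂ , proper₂ , at-t , second₂ =
    assemble _ Joins-sym c₁ (λ x~y _ → proper₁ x~y) c₂ (λ x~y _ → proper₂ x~y) apart
    where
    apart : ∀ s′ t′ → ¬ Joins (inj₁ (inj₂ s)) (inj₂ (inj₂ t)) (inj₁ (inj₂ s′)) (inj₂ (inj₂ t′)) →
            merge₁ (c₁ (inj₂ s′)) ≢ merge₂ (c₂ (inj₂ t′))
    apart s′ t′ ≢st with _≟ₕ_ {As = As} s′ s | _≟ₕ_ {As = Cs} t′ t
    ... | yes refl | yes refl = contradiction (inj₁ (refl , refl)) ≢st
    ... | yes refl | no t′≢t  = first≢second at-s (second₂ t′ t′≢t)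
    ... | no s′≢s  | yes refl = second≢first (second₁ s′ s′≢s) at-t
    ... | no s′≢s  | no t′≢t  = second≢second (second₁ s′ s′≢s) (second₂ t′ t′≢t)

  -- The side that loses an edge gets second-class hubs throughout, so the one hub coloured `zero`
  -- on the other side meets no clash.
  edge-deleted : ∀ u v → u ~ v → Σ[ f ∈ (W → Fin (suc (j + j′))) ]
    (∀ {x y} → x ~ y → ¬ Joins u v x y → f x ≢ f y)
  edge-deleted (inj₁ u) (inj₁ v) u~v
    with side-edge-deleted As u v u~v | only-first-class-at Cs (hub Cs)
  ... | c₁ , proper₁ , second₁ | c₂ , proper₂ , at-t , second₂ =
    assemble _ Joins-sym c₁ (λ x~y ¬E → proper₁ x~y (¬E ∘ Joins-map)) c₂ (λ x~y _ → proper₂ x~y) apart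
    where
    apart : ∀ s t → _ → merge₁ (c₁ (inj₂ s)) ≢ merge₂ (c₂ (inj₂ t))
    apart s t _ with _≟ₕ_ {As = Cs} t (hub Cs)
    ... | yes refl = second≢first (second₁ s) at-t
    ... | no t≢    = second≢second (second₁ s) (second₂ t t≢)
  edge-deleted (inj₂ u) (inj₂ v) u~v
    with only-first-class-at As (hub As) | side-edge-deleted Cs u v u~v
  ... | c₁ , proper₁ , at-s , second₁ | c₂ , proper₂ , second₂ =
    assemble _ Joins-sym c₁ (λ x~y _ → proper₁ x~y) c₂ (λ x~y ¬E → proper₂ x~y (¬E ∘ Joins-map)) apart
    where
    apart : ∀ s t → _ → merge₁ (c₁ (inj₂ s)) ≢ merge₂ (c₂ (inj₂ t))
    apart s t _ with _≟ₕ_ {As = As} s (hub As)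
    ... | yes refl = first≢second at-s (second₂ t)
    ... | no s≢    = second≢second (second₁ s s≢) (second₂ t)
  edge-deleted (inj₁ (inj₂ s)) (inj₂ (inj₂ t)) _ = hub-edge-deleted s t
  edge-deleted (inj₂ (inj₂ t)) (inj₁ (inj₂ s)) _ =
    let f , proper = hub-edge-deleted s t in f , λ x~y ≢ts → proper x~y (≢ts ∘ Sum.swap)

  enum : W ↔ Fin ((∣Base∣ As + ∣Hub∣ As) + (∣Base∣ Cs + ∣Hub∣ Cs))
  enum = ↔-trans
    (↔-trans (Base↔Fin As ⊎-↔ Hub↔Fin As) (↔-sym Finₚ.+↔⊎) ⊎-↔
     ↔-trans (Base↔Fin Cs ⊎-↔ Hub↔Fin Cs) (↔-sym Finₚ.+↔⊎))
    (↔-sym Finₚ.+↔⊎)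

  open FiniteGraph enum _~_ ~-dec (λ {x} {y} → ~-sym {x} {y}) (λ {x} → ~-irrefl {x}) public
    using (to; from; from∘to; from-injective; edge; finiteCrit)

  opaque
    toft : Crit (suc (j + j′))
    toft = finiteCrit uncolourable edge-deleted neighbour λ {x} {y} {z} → no-triangle {x} {y} {z}

    order-toft : ∣V∣ toft ≡ (∣Base∣ As + ∣Hub∣ As) + (∣Base∣ Cs + ∣Hub∣ Cs)
    order-toft = refl

-- Counting edges

lookup-injective : ∀ {A : Set} {xs : List A} → Unique xs → Injective _≡_ _≡_ (lookup xs)
lookup-injective (_ ∷ _)     {zero}  {zero}  _  = refl
lookup-injective (x∉xs ∷ _)  {zero}  {suc j} eq = contradiction eq (All.lookup x∉xs (∈-lookup j))
lookup-injective (x∉xs ∷ _)  {suc i} {zero}  eq = contradiction (sym eq) (All.lookup x∉xs (∈-lookup i))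
lookup-injective (_ ∷ xs!)   {suc i} {suc j} eq = cong suc (lookup-injective xs! eq)

index-injective : ∀ {A : Set} {xs : List A} {x y} (x∈xs : x List.∈ xs) (y∈xs : y List.∈ xs) →
                  Any.index x∈xs ≡ Any.index y∈xs → x ≡ y
index-injective {xs = xs} x∈xs y∈xs eq =
  trans (Anyₚ.lookup-index x∈xs) (trans (cong (lookup xs) eq) (sym (Anyₚ.lookup-index y∈xs)))

length-filter-¬ : ∀ {A : Set} {P : Pred A 0ℓ} (P? : U.Decidable P) xs →
                  length (filter (¬? ∘ P?) xs) + length (filter P? xs) ≡ length xs
length-filter-¬ P? []       = refl
length-filter-¬ P? (x ∷ xs) with P? x
... | yes _ = trans (ℕₚ.+-suc _ _) (cong suc (length-filter-¬ P? xs))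
... | no  _ = cong suc (length-filter-¬ P? xs)

module Edges (G : Graph) where
  open Graph G using (_~_; _~?_; ~-sym; ~-irrefl)

  Increasing : Pred (Vertex G × Vertex G) 0ℓ
  Increasing (x , y) = x Fin.< y × x ~ y

  increasing? : U.Decidable Increasing
  increasing? = uncurry λ x y → (x Finₚ.<? y) ×-dec (x ~? y)

  edges : List (Vertex G × Vertex G)
  edges = filter increasing? (cartesianProduct (allFin (order G)) (allFin (order G)))

  edges-unique : Unique edges
  edges-unique = Uniqueₚ.filter⁺ increasing?
    (Uniqueₚ.cartesianProduct⁺ (Uniqueₚ.allFin⁺ (order G)) (Uniqueₚ.allFin⁺ (order G)))

  edge# : Fin (size G) → Vertex G × Vertex G
  edge# = lookup edges

  edge#-injective : Injective _≡_ _≡_ edge#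
  edge#-injective = lookup-injective edges-unique

  edge#-increasing : ∀ i → Increasing (edge# i)
  edge#-increasing i = proj₂ (∈-filter⁻ increasing?
    {xs = cartesianProduct (allFin (order G)) (allFin (order G))} (∈-lookup i))

  increasing-SameEnds : ∀ {x y u v} → Increasing (x , y) → Increasing (u , v) →
                        SameEnds u v x y → (x , y) ≡ (u , v)
  increasing-SameEnds _ _ (inj₁ (refl , refl)) = refl
  increasing-SameEnds (x<y , _) (y<x , _) (inj₂ (refl , refl)) = contradiction y<x (Finₚ.<-asym x<y)

  edge#-SameEnds : ∀ {i j} → SameEnds (proj₁ (edge# j)) (proj₂ (edge# j)) (proj₁ (edge# i)) (proj₂ (edge# i)) → i ≡ j
  edge#-SameEnds {i} {j} = edge#-injective ∘ increasing-SameEnds (edge#-increasing i) (edge#-increasing j)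

  sorted : ∀ {x y} → x ~ y → ∃[ e ] (e List.∈ edges × SameEnds x y (proj₁ e) (proj₂ e))
  sorted {x} {y} x~y with Finₚ.<-cmp x y
  ... | tri< x<y _ _  = (x , y) ,
    ∈-filter⁺ increasing? (∈-cartesianProduct⁺ (∈-allFin x) (∈-allFin y)) (x<y , x~y) , inj₁ (refl , refl)
  ... | tri≈ _ refl _ = contradiction x~y ~-irrefl
  ... | tri> _ _ y<x  = (y , x) ,
    ∈-filter⁺ increasing? (∈-cartesianProduct⁺ (∈-allFin y) (∈-allFin x)) (y<x , ~-sym x~y) , inj₂ (refl , refl)

  SameEnds-trans : ∀ {x y x′ y′ a b : Vertex G} → SameEnds x y a b → SameEnds x′ y′ a b → SameEnds x y x′ y′
  SameEnds-trans (inj₁ (refl , refl)) (inj₁ (refl , refl)) = inj₁ (refl , refl)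
  SameEnds-trans (inj₁ (refl , refl)) (inj₂ (refl , refl)) = inj₂ (refl , refl)
  SameEnds-trans (inj₂ (refl , refl)) (inj₁ (refl , refl)) = inj₂ (refl , refl)
  SameEnds-trans (inj₂ (refl , refl)) (inj₂ (refl , refl)) = inj₁ (refl , refl)

  size-≥ : ∀ {n} (x y : Fin n → Vertex G) → (∀ i → x i ~ y i) →
           (∀ {i j} → SameEnds (x i) (y i) (x j) (y j) → i ≡ j) → n ≤ size G
  size-≥ x y adjacent injective = Finₚ.injective⇒≤ {f = λ i → Any.index (member i)} λ {i} {j} eq →
    injective (SameEnds-trans (ends i)
      (subst (λ e → SameEnds (x j) (y j) (proj₁ e) (proj₂ e)) (sym (index-injective (member i) (member j) eq)) (ends j)))
    where
    member = λ i → proj₁ (proj₂ (sorted (adjacent i)))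
    ends = λ i → proj₂ (proj₂ (sorted (adjacent i)))

-- Mantel's theorem: if v has maximal degree Δ, then N(v) is independent, so
-- every edge has an end outside N(v); each of these n − Δ vertices is on at
-- most Δ edges, whence size ≤ (n − Δ)Δ ≤ n²/4.
module _ (G : Graph) (no-triangle : NoTriangle G) where
  open Graph G using (_~_; _~?_; ~-sym; ~-irrefl)
  open Edges G

  private
    n = order G

    neighbours : Vertex G → List (Vertex G)
    neighbours w = filter (w ~?_) (allFin n)

    degree : Vertex G → ℕ
    degree w = length (neighbours w)

    module _ (v : Vertex G) (maximal : ∀ w → degree w ≤ degree v) where

      others : List (Vertex G)
      others = filter (λ w → ¬? (v ~? w)) (allFin n)

      record Oriented (e : Vertex G × Vertex G) : Set where
        field
          tail head : Vertex G
          adjacent  : tail ~ head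
          outside   : ¬ (v ~ tail)
          ends      : SameEnds (proj₁ e) (proj₂ e) tail head

        tail# : Fin (length others)
        tail# = Any.index (∈-filter⁺ (λ w → ¬? (v ~? w)) (∈-allFin tail) outside)

        head∈ : head List.∈ neighbours tail
        head∈ = ∈-filter⁺ (tail ~?_) (∈-allFin head) adjacent

        head# : Fin (degree v)
        head# = inject≤ (Any.index head∈) (maximal tail)

      orient : ∀ e → Increasing e → Oriented e
      orient (x , y) (_ , x~y) with v ~? x
      ... | yes v~x = record { adjacent = ~-sym x~y ; outside = λ v~y → no-triangle v~x x~y (~-sym v~y)
                             ; ends = inj₂ (refl , refl) }
      ... | no v≁x  = record { adjacent = x~y ; outside = v≁x ; ends = inj₁ (refl , refl) }

      oriented : ∀ i → Oriented (edge# i)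
      oriented i = orient (edge# i) (edge#-increasing i)

      open Oriented

      head-unique : ∀ {e e′} (p : Oriented e) (q : Oriented e′) → tail p ≡ tail q → head# p ≡ head# q → head p ≡ head q
      head-unique record { tail = t ; head = h ; adjacent = a } record { head = h′ ; adjacent = a′ } refl eq =
        index-injective (∈-filter⁺ (t ~?_) (∈-allFin h) a) (∈-filter⁺ (t ~?_) (∈-allFin h′) a′)
          (Finₚ.inject≤-injective (maximal t) (maximal t) _ _ eq)

      -- The second coordinate numbers the head among the neighbours of the tail; maximality of the
      -- degree of `v` makes one range wide enough for all tails.
      code : Fin (size G) → Fin (length others * degree v)
      code i = Fin.combine (tail# (oriented i)) (head# (oriented i))

      code-injective : Injective _≡_ _≡_ code
      code-injective {i} {k} eq = edge#-SameEnds (SameEnds-swap (ends (oriented i))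
          (subst₂ (SameEnds _ _) (sym t≡) (sym h≡) (ends (oriented k))))
        where
        t#,h# = Finₚ.combine-injective (tail# (oriented i)) (head# (oriented i))
                                       (tail# (oriented k)) (head# (oriented k)) eq
        t≡ = index-injective _ _ (proj₁ t#,h#)
        h≡ = head-unique (oriented i) (oriented k) t≡ (proj₂ t#,h#)

        SameEnds-swap : ∀ {x y x′ y′ a b : Vertex G} → SameEnds x y a b → SameEnds x′ y′ a b → SameEnds x′ y′ x y
        SameEnds-swap p q = SameEnds-trans q p

      size≤product : size G ≤ length others * degree v
      size≤product = Finₚ.injective⇒≤ code-injective

      others+degree : length others + degree v ≡ n
      others+degree = trans (length-filter-¬ (v ~?_) (allFin n)) (length-tabulate id)

    4ab≤[a+b]² : ∀ a b → 4 * (a * b) ≤ (a + b) * (a + b)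
    4ab≤[a+b]² a b = [ ordered , swapped ]′ (ℕₚ.≤-total a b)
      where
      open +-*-Solver
      ordered : ∀ {a b} → a ≤ b → 4 * (a * b) ≤ (a + b) * (a + b)
      ordered {a} a≤b with ℕₚ.m≤n⇒∃[o]m+o≡n a≤b
      ... | d , refl = ℕₚ.≤-trans (ℕₚ.m≤m+n _ (d * d)) (ℕₚ.≤-reflexive
        (solve 2 (λ a d → con 4 :* (a :* (a :+ d)) :+ d :* d := (a :+ (a :+ d)) :* (a :+ (a :+ d))) refl a d))

      swapped : b ≤ a → 4 * (a * b) ≤ (a + b) * (a + b)
      swapped b≤a rewrite ℕₚ.*-comm a b | ℕₚ.+-comm a b = ordered b≤a

    max-degree : Vertex G → Σ[ v ∈ Vertex G ] (∀ w → degree w ≤ degree v)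
    max-degree x = argmax degree x (allFin n) , λ w → All.lookup (f[xs]≤f[argmax] {f = degree} x (allFin n)) (∈-allFin w)

    -- A vertex is needed before one of maximal degree can be chosen; an end of the first edge
    -- serves, and without edges the inequality is trivial.
    bound : ∀ m → m ≡ size G → 4 * m ≤ n * n
    bound zero    _  = z≤n
    bound (suc m) eq with max-degree (proj₁ (edge# (subst Fin eq zero)))
    ... | v , maximal = ℕₚ.≤-trans (ℕₚ.*-monoʳ-≤ 4 (ℕₚ.≤-trans (ℕₚ.≤-reflexive eq) (size≤product v maximal)))
      (ℕₚ.≤-trans (4ab≤[a+b]² (length (others v maximal)) (degree v))
        (ℕₚ.≤-reflexive (cong (λ k → k * k) (others+degree v maximal))))

  mantel : 4 * size G ≤ n * n
  mantel = bound (size G) refl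

-- Triangles and odd-girth

module _ (G : Graph) where
  open Graph G using (_~_; ~-irrefl)

  OddGirth>3⇒TriangleFree : OddGirth> 3 G → TriangleFree G
  OddGirth>3⇒TriangleFree og c = ℕₚ.<-irrefl refl (og 3 odd c)
    where
    odd : ¬ (2 ∣ 3)
    odd (divides zero ())
    odd (divides (suc zero) ())
    odd (divides (suc (suc _)) ())

  TriangleFree⇒NoTriangle : TriangleFree G → NoTriangle G
  TriangleFree⇒NoTriangle tf {x} {y} {z} xy yz zx = tf record
    { long = s≤s (s≤s (s≤s z≤n)) ; vertex = vertex ; distinct = distinct ; adjacent = adjacent }
    where
    ~⇒≢ : ∀ {a b} → a ~ b → a ≢ b
    ~⇒≢ a~b refl = ~-irrefl a~b

    vertex : Fin 3 → Vertex G
    vertex zero             = x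
    vertex (suc zero)       = y
    vertex (suc (suc zero)) = z

    distinct : Injective _≡_ _≡_ vertex
    distinct {zero}           {zero}           _  = refl
    distinct {zero}           {suc zero}       eq = contradiction eq (~⇒≢ xy)
    distinct {zero}           {suc (suc zero)} eq = contradiction (sym eq) (~⇒≢ zx)
    distinct {suc zero}       {zero}           eq = contradiction (sym eq) (~⇒≢ xy)
    distinct {suc zero}       {suc zero}       _  = refl
    distinct {suc zero}       {suc (suc zero)} eq = contradiction eq (~⇒≢ yz)
    distinct {suc (suc zero)} {zero}           eq = contradiction eq (~⇒≢ zx)
    distinct {suc (suc zero)} {suc zero}       eq = contradiction (sym eq) (~⇒≢ yz)
    distinct {suc (suc zero)} {suc (suc zero)} _  = refl

    adjacent : ∀ i → vertex i ~ vertex (cyclicSuc i)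
    adjacent zero             = xy
    adjacent (suc zero)       = yz
    adjacent (suc (suc zero)) = zx

  NoTriangle⇒OddGirth>3 : NoTriangle G → OddGirth> 3 G
  NoTriangle⇒OddGirth>3 nt m _ c with ℕₚ.m≤n⇒m<n∨m≡n (Cycle.long c)
  ... | inj₁ 3<m  = 3<m
  ... | inj₂ refl = ⊥-elim (nt (adjacent zero) (adjacent (suc zero)) (adjacent (suc (suc zero))))
    where open Cycle c

opaque
  unfolding Toft.toft

  -- The edges inside `C` are counted for the sake of density 4/31, where the order of `C` is a
  -- positive fraction of the whole order.
  toft-size : ∀ {j j′} (As : Chain (suc (suc j′)) j) (C : Crit (suc j)) (Cs : Chain (suc (suc j)) j′) →
              ∣Hub∣ As * ∣Hub∣ (C ∷ Cs) + size (graph C) ≤ size (graph (Toft.toft As (C ∷ Cs)))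
  toft-size As C Cs = Edges.size-≥ (graph toft) (to ∘ x) (to ∘ y) (λ i → edge {x i} {y i} (adjacent i))
      (λ {i} {k} → apart i k ∘ Sum.map both both)
    where
    open Toft As (C ∷ Cs)
    H : ℕ
    H = ∣Hub∣ As * ∣Hub∣ (C ∷ Cs)

    inC : Crit.V C → W
    inC v = inj₂ (inj₁ (inj₁ v))

    ends : Fin H ⊎ Fin (size (graph C)) → W × W
    ends (inj₁ k) = inj₁ (inj₂ (Inverse.from (Hub↔Fin As) (proj₁ (Fin.remQuot {∣Hub∣ As} (∣Hub∣ (C ∷ Cs)) k))))
                  , inj₂ (inj₂ (Inverse.from (Hub↔Fin (C ∷ Cs)) (proj₂ (Fin.remQuot {∣Hub∣ As} (∣Hub∣ (C ∷ Cs)) k))))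
    ends (inj₂ k) = inC (proj₁ (Edges.edge# (graph C) k))
                  , inC (proj₂ (Edges.edge# (graph C) k))

    x y : Fin (H + size (graph C)) → W
    x i = proj₁ (ends (Fin.splitAt H i))
    y i = proj₂ (ends (Fin.splitAt H i))

    to-injective : ∀ {u v} → to u ≡ to v → u ≡ v
    to-injective {u} {v} eq = trans (sym (from∘to u)) (trans (cong from eq) (from∘to v))

    both : ∀ {a b c d} → to a ≡ to b × to c ≡ to d → a ≡ b × c ≡ d
    both (p , q) = to-injective p , to-injective q

    adjacent : ∀ i → x i ~ y i
    adjacent i with Fin.splitAt H i
    ... | inj₁ _ = _
    ... | inj₂ k = proj₂ (Edges.edge#-increasing (graph C) k)

    from-hub-injective : ∀ {m n} (Bs : Chain m n) {a b} →
                         Inverse.from (Hub↔Fin Bs) a ≡ Inverse.from (Hub↔Fin Bs) b → a ≡ b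
    from-hub-injective Bs eq = trans (sym (Inverse.strictlyInverseˡ (Hub↔Fin Bs) _))
      (trans (cong (Inverse.to (Hub↔Fin Bs)) eq) (Inverse.strictlyInverseˡ (Hub↔Fin Bs) _))

    ends-apart : ∀ s t → Joins (proj₁ (ends s)) (proj₂ (ends s)) (proj₁ (ends t)) (proj₂ (ends t)) → s ≡ t
    ends-apart (inj₁ k) (inj₁ l) (inj₁ (p , q)) = cong inj₁ (trans (sym (Finₚ.combine-remQuot {∣Hub∣ As} _ k))
      (trans (cong₂ Fin.combine
          (from-hub-injective As (sym (Sumₚ.inj₂-injective (Sumₚ.inj₁-injective p))))
          (from-hub-injective (C ∷ Cs) (sym (Sumₚ.inj₂-injective (Sumₚ.inj₂-injective q)))))
        (Finₚ.combine-remQuot {∣Hub∣ As} _ l)))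
    ends-apart (inj₁ k) (inj₁ l) (inj₂ (() , _))
    ends-apart (inj₁ k) (inj₂ l) (inj₁ (() , _))
    ends-apart (inj₁ k) (inj₂ l) (inj₂ (() , _))
    ends-apart (inj₂ k) (inj₁ l) (inj₁ (() , _))
    ends-apart (inj₂ k) (inj₁ l) (inj₂ (() , _))
    ends-apart (inj₂ k) (inj₂ l) E = cong inj₂ (sym (Edges.edge#-SameEnds (graph C) (Sum.map strip strip E)))
      where
      strip : ∀ {a b c d : Crit.V C} →
              inC a ≡ inC b × inC c ≡ inC d → a ≡ b × c ≡ d
      strip (refl , refl) = refl , refl

    apart : ∀ i k → Joins (x i) (y i) (x k) (y k) → i ≡ k
    apart i k E = trans (sym (Finₚ.join-splitAt H _ i))
      (trans (cong (Fin.join H _) (ends-apart (Fin.splitAt H i) (Fin.splitAt H k) E)) (Finₚ.join-splitAt H _ k))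

-- Odd cycles

module OddCycle (p : ℕ) where

  -- The length `suc last` is odd, and starting at 5 excludes the triangle.
  last : ℕ
  last = 4 + 2 * p

  Follows : ℕ → ℕ → Set
  Follows a b = b ≡ suc a ⊎ (a ≡ last × b ≡ 0)

  no-3-cycle : ∀ {a b c} → Follows a b → Follows b c → ¬ Follows c a
  no-3-cycle (inj₁ refl)          (inj₁ refl)          (inj₁ ())
  no-3-cycle (inj₁ refl)          (inj₁ refl)          (inj₂ (() , refl))
  no-3-cycle (inj₁ refl)          (inj₂ (() , refl))   (inj₁ refl)
  no-3-cycle (inj₁ refl)          (inj₂ (_ , refl))    (inj₂ (() , _))
  no-3-cycle (inj₂ (refl , refl)) (inj₁ refl)          (inj₁ ())
  no-3-cycle (inj₂ (refl , refl)) (inj₁ refl)          (inj₂ (() , _))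
  no-3-cycle (inj₂ (refl , refl)) (inj₂ (() , _))      _

  V : Set
  V = Fin (suc last)

  _⇝_ : Rel V 0ℓ
  x ⇝ y = Follows (toℕ x) (toℕ y)

  _⇝?_ : Decidable _⇝_
  x ⇝? y = (toℕ y ℕ.≟ suc (toℕ x)) ⊎-dec ((toℕ x ℕ.≟ last) ×-dec (toℕ y ℕ.≟ 0))

  ⇝-irrefl : ∀ {x} → ¬ (x ⇝ x)
  ⇝-irrefl (inj₁ eq)         = ℕₚ.1+n≢n (sym eq)
  ⇝-irrefl (inj₂ (eq , eq′)) = case trans (sym eq) eq′ of λ ()

  not-last : ∀ {x y : V} → toℕ x ≡ last → toℕ y ≢ suc (toℕ x)
  not-last {y = y} x≡last y≡1+x = ℕₚ.<-irrefl (trans y≡1+x (cong suc x≡last)) (Finₚ.toℕ<n y)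

  ⇝-functional : ∀ {x y z} → x ⇝ y → x ⇝ z → y ≡ z
  ⇝-functional (inj₁ y≡)       (inj₁ z≡)       = Finₚ.toℕ-injective (trans y≡ (sym z≡))
  ⇝-functional (inj₁ y≡)       (inj₂ (x≡ , _)) = contradiction y≡ (not-last x≡)
  ⇝-functional (inj₂ (x≡ , _)) (inj₁ z≡)       = contradiction z≡ (not-last x≡)
  ⇝-functional (inj₂ (_ , y≡)) (inj₂ (_ , z≡)) = Finₚ.toℕ-injective (trans y≡ (sym z≡))

  ⇝-injective : ∀ {x y z} → x ⇝ z → y ⇝ z → x ≡ y
  ⇝-injective (inj₁ z≡)       (inj₁ z≡′)       = Finₚ.toℕ-injective (ℕₚ.suc-injective (trans (sym z≡) z≡′))
  ⇝-injective (inj₁ z≡)       (inj₂ (_ , z≡0)) = case trans (sym z≡) z≡0 of λ ()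
  ⇝-injective (inj₂ (_ , z≡0)) (inj₁ z≡)       = case trans (sym z≡) z≡0 of λ ()
  ⇝-injective (inj₂ (x≡ , _)) (inj₂ (y≡ , _))  = Finₚ.toℕ-injective (trans x≡ (sym y≡))

  cycle : Graph
  cycle = record
    { order    = suc last
    ; _~_      = λ x y → x ⇝ y ⊎ y ⇝ x
    ; _~?_     = λ x y → (x ⇝? y) ⊎-dec (y ⇝? x)
    ; ~-sym    = Sum.swap
    ; ~-irrefl = [ ⇝-irrefl , ⇝-irrefl ]′
    }

  open Graph cycle using (_~_)

  no-triangle : ∀ {x y z} → x ~ y → y ~ z → ¬ (z ~ x)
  no-triangle (inj₁ xy) (inj₁ yz) (inj₁ zx) = no-3-cycle xy yz zx
  no-triangle (inj₁ xy) (inj₁ yz) (inj₂ xz) = ⇝-irrefl (subst (_ ⇝_) (⇝-functional xz xy) yz)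
  no-triangle (inj₁ xy) (inj₂ zy) zx        = Graph.~-irrefl cycle (subst (_ ~_) (⇝-injective xy zy) zx)
  no-triangle (inj₂ yx) (inj₁ yz) zx        = Graph.~-irrefl cycle (subst (_ ~_) (⇝-functional yx yz) zx)
  no-triangle (inj₂ yx) (inj₂ zy) (inj₁ zx) = ⇝-irrefl (subst (_ ⇝_) (⇝-functional zx zy) yx)
  no-triangle (inj₂ yx) (inj₂ zy) (inj₂ xz) = no-3-cycle xz zy yx

  flip : Fin 2 → Fin 2
  flip zero       = suc zero
  flip (suc zero) = zero

  flip≢ : ∀ c → c ≢ flip c
  flip≢ zero       ()
  flip≢ (suc zero) ()

  ≢⇒flip : ∀ {c d} → c ≢ d → d ≡ flip c
  ≢⇒flip {zero}     {zero}     c≢d = contradiction refl c≢d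
  ≢⇒flip {zero}     {suc zero} _   = refl
  ≢⇒flip {suc zero} {zero}     _   = refl
  ≢⇒flip {suc zero} {suc zero} c≢d = contradiction refl c≢d

  alternate : Fin 2 → ℕ → Fin 2
  alternate c zero    = c
  alternate c (suc k) = flip (alternate c k)

  alternate-even : ∀ c k → alternate c (2 * k) ≡ c
  alternate-even c zero    = refl
  alternate-even c (suc k) rewrite ℕₚ.+-suc k (k + 0) = trans (flip-flip _) (alternate-even c k)
    where
    flip-flip : ∀ d → flip (flip d) ≡ d
    flip-flip zero       = refl
    flip-flip (suc zero) = refl

  alternate-last : ∀ c → alternate c last ≡ c
  alternate-last c = trans (cong (alternate c) (sym (ℕₚ.*-distribˡ-+ 2 2 p))) (alternate-even c (2 + p))

  uncolourable : ¬ Colorable cycle 2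
  uncolourable (f , proper) =
    proper (inj₁ (inj₂ (Finₚ.toℕ-fromℕ< (ℕₚ.n<1+n last) , refl)))
      (trans (alternates last (ℕₚ.n<1+n last)) (alternate-last (f zero)))
    where
    alternates : ∀ k (k<n : k < suc last) → f (Fin.fromℕ< k<n) ≡ alternate (f zero) k
    alternates zero    _   = refl
    alternates (suc k) k<n = trans
      (≢⇒flip (proper (inj₁ (inj₁ (trans (Finₚ.toℕ-fromℕ< k<n) (cong suc (sym (Finₚ.toℕ-fromℕ< k<n′))))))))
      (cong flip (alternates k k<n′))
      where k<n′ = ℕₚ.<-trans (ℕₚ.n<1+n k) k<n

  -- Two colours alternate along the cycle with a single repetition, shifted to lie between `u` and
  -- its successor. If `u` is the last vertex no shift is made, and the repetition falls on the
  -- closing arc because `last` is even.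
  arc-deleted : ∀ u v → u ⇝ v → Colorable (deleteEdge cycle u v) 2
  arc-deleted u v u⇝v = f , λ
    { (inj₁ x⇝y , ≢uv) → proper x⇝y ≢uv
    ; (inj₂ y⇝x , ≢uv) → ≢-sym (proper y⇝x (≢uv ∘ Sum.swap ∘ Sum.map Product.swap Product.swap)) }
    where
    f : V → Fin 2
    f x with toℕ x ℕ.≤? toℕ u
    ... | yes _ = alternate zero (toℕ x)
    ... | no  _ = alternate zero (suc (toℕ x))

    0≤u : ∀ {x : V} → toℕ x ≡ 0 → toℕ x ≤ toℕ u
    0≤u x≡0 = ℕₚ.≤-trans (ℕₚ.≤-reflexive x≡0) z≤n

    proper : ∀ {x y} → x ⇝ y → ¬ SameEnds u v x y → f x ≢ f y
    proper {x} {y} x⇝y ≢uv with toℕ x ℕ.≤? toℕ u | toℕ y ℕ.≤? toℕ u | x⇝y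
    ... | yes _ | yes _ | inj₁ y≡ rewrite y≡ = flip≢ _
    ... | no _  | no _  | inj₁ y≡ rewrite y≡ = flip≢ _
    ... | no x≰u | yes y≤u | inj₁ y≡ =
      contradiction (ℕₚ.≤-trans (ℕₚ.n≤1+n _) (ℕₚ.≤-trans (ℕₚ.≤-reflexive (sym y≡)) y≤u)) x≰u
    ... | yes x≤u | no y≰u | inj₁ y≡ = contradiction (inj₁ (x≡u , ⇝-functional (inj₁ y≡) (subst (_⇝ v) (sym x≡u) u⇝v))) ≢uv
      where x≡u = Finₚ.toℕ-injective (ℕₚ.≤-antisym x≤u (ℕₚ.≤-pred (subst (toℕ u <_) y≡ (ℕₚ.≰⇒> y≰u))))
    ... | _ | no y≰u | inj₂ (_ , y≡0) = contradiction (0≤u y≡0) y≰u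
    ... | no _ | yes _ | inj₂ (x≡ , y≡0) rewrite x≡ | y≡0 =
      λ eq → flip≢ zero (trans (sym eq) (cong flip (alternate-last zero)))
    ... | yes x≤u | yes _ | inj₂ (x≡ , y≡0) =
      contradiction (inj₁ (x≡u , ⇝-functional (inj₂ (x≡ , y≡0)) (subst (_⇝ v) (sym x≡u) u⇝v))) ≢uv
      where x≡u = Finₚ.toℕ-injective (ℕₚ.≤-antisym x≤u
                    (ℕₚ.≤-trans (ℕₚ.≤-pred (Finₚ.toℕ<n u)) (ℕₚ.≤-reflexive (sym x≡))))

  oddCycle : Crit 2
  oddCycle = crit cycle uncolourable edge-deleted neighbour no-triangle
    where
    edge-deleted : ∀ u v → u ~ v → Colorable (deleteEdge cycle u v) 2
    edge-deleted u v (inj₁ u⇝v) = arc-deleted u v u⇝v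
    edge-deleted u v (inj₂ v⇝u) = let f , proper = arc-deleted v u v⇝u in
      f , λ (x~y , ≢uv) → proper (x~y , ≢uv ∘ Sum.swap)

    neighbour : ∀ v → ∃[ w ] v ~ w
    neighbour zero    = suc zero , inj₁ (inj₁ refl)
    neighbour (suc i) = Fin.inject₁ i , inj₂ (inj₁ (cong suc (sym (Finₚ.toℕ-inject₁ i))))

open OddCycle using (oddCycle)

-- Rational densities

HasDensity>⇔ : ∀ c G → HasDensity> c G ⇔ (↥ c ℤ.* + (order G * order G) ℤ.< + size G ℤ.* ↧ c)
HasDensity>⇔ c@(mkℚ a d-1 _) G = mk⇔
  (λ h → subst₂ ℤ._<_ lhs≡ rhs≡ (ℚᵘₚ.drop-*<* (ℚᵘₚ.<-respˡ-≃ lhs≃ (ℚᵘₚ.<-respʳ-≃ rhs≃ (ℚₚ.toℚᵘ-mono-< h)))))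
  (λ h → ℚₚ.toℚᵘ-cancel-< (ℚᵘₚ.<-respˡ-≃ (ℚᵘₚ.≃-sym lhs≃) (ℚᵘₚ.<-respʳ-≃ (ℚᵘₚ.≃-sym rhs≃)
           (ℚᵘ.*<* (subst₂ ℤ._<_ (sym lhs≡) (sym rhs≡) h)))))
  where
  N = order G * order G
  M = size G

  lhs≃ : ℚ.toℚᵘ (c ℚ.* (+ N ℚ./ 1)) ℚᵘ.≃ ℚ.toℚᵘ c ℚᵘ.* ℚᵘ.mkℚᵘ (+ N) 0
  lhs≃ = ℚᵘₚ.≃-trans (ℚₚ.toℚᵘ-homo-* c (+ N ℚ./ 1))
                     (ℚᵘₚ.*-congˡ {ℚ.toℚᵘ c} (ℚₚ.toℚᵘ-fromℚᵘ (ℚᵘ.mkℚᵘ (+ N) 0)))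

  rhs≃ : ℚ.toℚᵘ (+ M ℚ./ 1) ℚᵘ.≃ ℚᵘ.mkℚᵘ (+ M) 0
  rhs≃ = ℚₚ.toℚᵘ-fromℚᵘ (ℚᵘ.mkℚᵘ (+ M) 0)

  lhs≡ : a ℤ.* + N ℤ.* + 1 ≡ a ℤ.* + N
  lhs≡ = ℤₚ.*-identityʳ _

  rhs≡ : + M ℤ.* + suc (d-1 * 1) ≡ + M ℤ.* + suc d-1
  rhs≡ = cong (λ d → + M ℤ.* + suc d) (ℕₚ.*-identityʳ d-1)

-- If s < a / b and D is the denominator of s, then s ≤ (a D - 1) / (b D).
HasDensity>-below : ∀ {s r : ℚ} {a b} → s ℚ.< r → ↥ r ≡ + a → ↧ r ≡ + suc b → ∀ G →
  (let N = order G * order G; D = ↧ₙ s in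
   a * D * N < suc b * D * size G + N) → HasDensity> s G
HasDensity>-below {s} {r} {a} {b} s<r ↥r≡ ↧r≡ G aDN< = Equivalence.from (HasDensity>⇔ s G)
  (ℤₚ.*-cancelˡ-<-nonNeg (+ suc b) (ℤₚ.≰⇒> λ ≥ → ℤₚ.<⇒≱ N+< (ℤₚ.+-monoʳ-≤ (+ N) ≥)))
  where
  open ℤₚ.≤-Reasoning
  open ℤSolver.+-*-Solver
  N = order G * order G
  M = size G
  D = ↧ₙ s

  N+< : + N ℤ.+ + suc b ℤ.* (↥ s ℤ.* + N) ℤ.< + N ℤ.+ + suc b ℤ.* (+ M ℤ.* + D)
  N+< = begin-strict
    + N ℤ.+ + suc b ℤ.* (↥ s ℤ.* + N)
      ≡⟨ solve 3 (λ N b s → N :+ b :* (s :* N) := (con (+ 1) :+ s :* b) :* N) refl (+ N) (+ suc b) (↥ s) ⟩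
    ℤ.suc (↥ s ℤ.* + suc b) ℤ.* + N
      ≤⟨ ℤₚ.*-monoʳ-≤-nonNeg (+ N) (ℤₚ.i<j⇒suc[i]≤j
           (subst₂ (λ x y → ↥ s ℤ.* x ℤ.< y ℤ.* ↧ s) ↧r≡ ↥r≡ (ℚₚ.drop-*<* s<r))) ⟩
    + a ℤ.* + D ℤ.* + N
      ≡⟨ trans (cong (ℤ._* + N) (sym (ℤₚ.pos-* a D))) (sym (ℤₚ.pos-* (a * D) N)) ⟩
    + (a * D * N)
      <⟨ ℤ.+<+ aDN< ⟩
    + (suc b * D * M + N)
      ≡⟨ cong (λ k → + (k + N)) (trans (ℕₚ.*-assoc (suc b) D M) (cong (suc b *_) (ℕₚ.*-comm D M))) ⟩
    + (suc b * (M * D) + N)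
      ≡⟨ trans (ℤₚ.pos-+ (suc b * (M * D)) N)
           (cong (ℤ._+ + N) (trans (ℤₚ.pos-* (suc b) (M * D)) (cong (+ suc b ℤ.*_) (ℤₚ.pos-* M D)))) ⟩
    + suc b ℤ.* (+ M ℤ.* + D) ℤ.+ + N
      ≡⟨ ℤₚ.+-comm (+ suc b ℤ.* (+ M ℤ.* + D)) (+ N) ⟩
    + N ℤ.+ + suc b ℤ.* (+ M ℤ.* + D) ∎

-- Infinite families

order-cong : ∀ {G H} → G ≅ H → order G ≡ order H
order-cong G≅H = ℕₚ.≤-antisym (Finₚ.injective⇒≤ (injective vertices)) (Finₚ.injective⇒≤ (injective (↔-sym vertices)))
  where
  open _≅_ G≅H
  injective : ∀ {m n} (e : Fin m ↔ Fin n) → Injective _≡_ _≡_ (Inverse.to e)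
  injective e eq = trans (sym (Inverse.strictlyInverseʳ e _)) (trans (cong (Inverse.from e) eq) (Inverse.strictlyInverseʳ e _))

unbounded⇒InfinitelyMany : ∀ {a} (P : Pred Graph a) → (∀ n → Σ[ G ∈ Graph ] (n ≤ order G × G ∈ P)) → InfinitelyMany P
unbounded⇒InfinitelyMany P pick = proj₁ ∘ graphs , proj₂ ∘ graphs , distinct
  where
  graphs : ℕ → Σ[ G ∈ Graph ] G ∈ P
  graphs zero    = let G , _ , G∈P = pick 0 in G , G∈P
  graphs (suc i) = let G , _ , G∈P = pick (suc (order (proj₁ (graphs i)))) in G , G∈P

  #_ : ℕ → ℕ
  # i = order (proj₁ (graphs i))

  increasing : ∀ {i j} → i < j → # i < # j
  increasing {i} {suc j} i<1+j with ℕₚ.m≤n⇒m<n∨m≡n (ℕₚ.≤-pred i<1+j)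
  ... | inj₁ i<j  = ℕₚ.<-trans (increasing i<j) (proj₁ (proj₂ (pick (suc (# j)))))
  ... | inj₂ refl = proj₁ (proj₂ (pick (suc (# j))))

  distinct : ∀ {i j} → proj₁ (graphs i) ≅ proj₁ (graphs j) → i ≡ j
  distinct {i} {j} G≅H with ℕₚ.<-cmp i j
  ... | tri< i<j _ _ = contradiction (order-cong G≅H) (ℕₚ.<⇒≢ (increasing i<j))
  ... | tri≈ _ i≡j _ = i≡j
  ... | tri> _ _ j<i = contradiction (sym (order-cong G≅H)) (ℕₚ.<⇒≢ (increasing j<i))

-- After division by `b * D` times the squared order: arbitrarily large graphs have density above
-- `a / b` minus `1 / (b * D)`. A rational below `a / b` with denominator `D` lies at least that far
-- below it.
Dense : ℕ → ℕ → ℕ → Set₁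
Dense o a b = ∀ D n → 1 ≤ D → Σ[ A ∈ Crit o ] (n ≤ ∣V∣ A
  × a * D * (∣V∣ A * ∣V∣ A) < b * D * size (graph A) + ∣V∣ A * ∣V∣ A)

Dense⇒DensityConstants : ∀ {o a b r s} → Dense o a (suc b) → ↥ r ≡ + a → ↧ r ≡ + suc b → s ℚ.< r →
                         s ∈ DensityConstants 3 (suc o)
Dense⇒DensityConstants {o} {s = s} dense ↥r≡ ↧r≡ s<r = unbounded⇒InfinitelyMany
  (λ G → IsCritical (suc o) G × OddGirth> 3 G × HasDensity> s G) λ n →
  let A , n≤ , bound = dense (↧ₙ s) n (s≤s z≤n) in
  graph A , n≤ , Crit.critical A , NoTriangle⇒OddGirth>3 (graph A) (Crit.no-triangle A) ,
  HasDensity>-below s<r ↥r≡ ↧r≡ (graph A) bound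

-- Mantel's theorem, applied to the first graph of the family, excludes any density above 1/4.
DensityConstants-Sup≤ : ∀ k → Sup≤ (DensityConstants 3 k) (+ 1 ℚ./ 4)
DensityConstants-Sup≤ k s (G , G∈ , _) = ℚₚ.≮⇒≥ λ 1/4<s →
  let G₀ = G 0
      _ , og , dense = G∈ 0
      N = order G₀ * order G₀
      instance N/1≥0 : ℚ.NonNegative (+ N ℚ./ 1)
               N/1≥0 = ℚₚ.normalize-nonNeg N 1
      denser : HasDensity> (+ 1 ℚ./ 4) G₀
      denser = ℚₚ.≤-<-trans (ℚₚ.*-monoʳ-≤-nonNeg (+ N ℚ./ 1) (ℚₚ.<⇒≤ 1/4<s)) dense
      N<4M = Equivalence.to (HasDensity>⇔ (+ 1 ℚ./ 4) G₀) denser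
      N<4M′ : N < 4 * size G₀
      N<4M′ = ℤₚ.drop‿+<+ (subst₂ ℤ._<_ (ℤₚ.*-identityˡ (+ N))
                (trans (sym (ℤₚ.pos-* (size G₀) 4)) (cong +_ (ℕₚ.*-comm (size G₀) 4))) N<4M)
  in ℕₚ.<⇒≱ N<4M′ (mantel G₀ (TriangleFree⇒NoTriangle G₀ (OddGirth>3⇒TriangleFree G₀ og)))

Dense⇒Sup≥ : ∀ {o a b} r → Dense o a (suc b) → ↥ r ≡ + a → ↧ r ≡ + suc b → Sup≥ (DensityConstants 3 (suc o)) r
Dense⇒Sup≥ r dense ↥r≡ ↧r≡ q q<r =
  let s , q<s , s<r = ℚₚ.<-dense q<r in s , Dense⇒DensityConstants dense ↥r≡ ↧r≡ s<r , q<s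

-- Density estimates for Toft's graphs

hubs≤size : (As : Chain (suc (suc j′)) j) (Cs : Chain (suc j) (suc j′)) →
            ∣Hub∣ As * ∣Hub∣ Cs ≤ size (graph (Toft.toft As Cs))
hubs≤size As (C ∷ Cs) = ℕₚ.≤-trans (ℕₚ.m≤m+n _ _) (toft-size As C Cs)

m+m≤n⇒m<n : ∀ {m n} → m + m ≤ n → 1 ≤ n → m < n
m+m≤n⇒m<n {m} {n} m+m≤n 1≤n = ℕₚ.≰⇒> λ n≤m →
  ℕₚ.<⇒≱ (ℕₚ.m<m+n n 1≤n) (ℕₚ.≤-trans (ℕₚ.+-mono-≤ n≤m n≤m) m+m≤n)

-- Vertices E that are few compared with the n₀ ones carrying density a / b
-- cost less than 1 / (b D) of density.
dense-bound : ∀ a b D n₀ E {n S} → n ≡ n₀ + E → a * (n₀ * n₀) ≤ b * S → 4 * (a * D * E) ≤ n₀ → 1 ≤ n₀ →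
              a * D * (n * n) < b * D * S + n * n
dense-bound a b D n₀ E {n} {S} refl an₀²≤bS 4X≤n₀ 1≤n₀ = begin-strict
  a * D * (n * n)                         ≡⟨ solve 4 (λ a D n₀ E →
    a :* D :* ((n₀ :+ E) :* (n₀ :+ E)) := D :* (a :* (n₀ :* n₀)) :+ a :* D :* E :* (con 2 :* n₀ :+ E))
    refl a D n₀ E ⟩
  D * (a * (n₀ * n₀)) + X * (2 * n₀ + E)  ≤⟨ ℕₚ.+-monoˡ-≤ _ (ℕₚ.*-monoʳ-≤ D an₀²≤bS) ⟩
  D * (b * S) + X * (2 * n₀ + E)          <⟨ ℕₚ.+-monoʳ-< (D * (b * S)) (m+m≤n⇒m<n 2Y≤n² (ℕₚ.*-mono-≤ 1≤n 1≤n)) ⟩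
  D * (b * S) + n * n                     ≡⟨ cong (_+ n * n) (solve 3 (λ b D S → D :* (b :* S) := b :* D :* S) refl b D S) ⟩
  b * D * S + n * n                       ∎
  where
  open ℕₚ.≤-Reasoning
  open +-*-Solver
  X = a * D * E

  1≤n : 1 ≤ n
  1≤n = ℕₚ.≤-trans 1≤n₀ (ℕₚ.m≤m+n n₀ E)

  2Y≤n² : X * (2 * n₀ + E) + X * (2 * n₀ + E) ≤ n * n
  2Y≤n² = begin
    X * (2 * n₀ + E) + X * (2 * n₀ + E)                  ≤⟨ ℕₚ.m≤m+n _ (2 * (X * E)) ⟩
    X * (2 * n₀ + E) + X * (2 * n₀ + E) + 2 * (X * E)    ≡⟨ solve 3 (λ X n₀ E →
      X :* (con 2 :* n₀ :+ E) :+ X :* (con 2 :* n₀ :+ E) :+ con 2 :* (X :* E) := con 4 :* X :* (n₀ :+ E))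
      refl X n₀ E ⟩
    4 * X * n                                            ≤⟨ ℕₚ.*-monoˡ-≤ n 4X≤n₀ ⟩
    n₀ * n                                               ≤⟨ ℕₚ.*-monoˡ-≤ n (ℕₚ.m≤m+n n₀ E) ⟩
    n * n                                                ∎

-- A chain of one graph has as many base vertices as hubs, so each hub set is a quarter of the
-- vertices; this gives 1/16.
toft₄ : ∀ p → Σ[ A ∈ Crit 3 ] (let m = 5 + 2 * p in ∣V∣ A ≡ 4 * m × m * m ≤ size (graph A))
toft₄ p = Toft.toft (C ∷ []) (C ∷ []) ,
  trans (Toft.order-toft (C ∷ []) (C ∷ [])) (solve 1 (λ m → (m :+ con 0) :+ m :* con 1 :+ ((m :+ con 0) :+ m :* con 1) := con 4 :* m) refl m) ,
  ℕₚ.≤-trans (ℕₚ.≤-reflexive (cong₂ _*_ (sym (ℕₚ.*-identityʳ m)) (sym (ℕₚ.*-identityʳ m))))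
             (hubs≤size (C ∷ []) (C ∷ []))
  where
  open +-*-Solver
  m = 5 + 2 * p
  C = oddCycle p

toft₄-dense : ∀ D m {n S} → n ≡ 4 * m → m * m ≤ S → 1 ≤ m → 1 * D * (n * n) < 16 * D * S + n * n
toft₄-dense D m {S = S} n≡4m m²≤S 1≤m = dense-bound 1 16 D (4 * m) 0 (trans n≡4m (sym (ℕₚ.+-identityʳ (4 * m))))
  (begin
    1 * (4 * m * (4 * m)) ≡⟨ solve 1 (λ m → con 1 :* (con 4 :* m :* (con 4 :* m)) := con 16 :* (m :* m)) refl m ⟩
    16 * (m * m)          ≤⟨ ℕₚ.*-monoʳ-≤ 16 m²≤S ⟩
    16 * S                ∎)
  (ℕₚ.≤-trans (ℕₚ.≤-reflexive (cong (4 *_) (ℕₚ.*-zeroʳ (1 * D)))) z≤n)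
  (ℕₚ.≤-trans 1≤m (ℕₚ.m≤n*m m 4))
  where
  open ℕₚ.≤-Reasoning
  open +-*-Solver

n≤5+2n : ∀ n → n ≤ 5 + 2 * n
n≤5+2n n = ℕₚ.≤-trans (ℕₚ.m≤m+n n _) (ℕₚ.m≤n+m _ 5)

dense₄ : Dense 3 1 16
dense₄ D n _ =
  let A , ∣A∣≡4m , m²≤size = toft₄ n in
  A ,
  ℕₚ.≤-trans (n≤5+2n n) (subst (5 + 2 * n ≤_) (sym ∣A∣≡4m) (ℕₚ.m≤n*m (5 + 2 * n) 4)) ,
  toft₄-dense D (5 + 2 * n) ∣A∣≡4m m²≤size (s≤s z≤n)

-- On one side the hubs are the pairs from a cycle of length 15u and a
-- 4-critical graph of order 4u.  On the other they are matched with a Toft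
-- graph of order 4(8u² + 1), which itself contributes 1/16 of its order squared.
module _ (D u : ℕ) (5≤u : 5 ≤ u) (4D≤u : 4 * D ≤ u) {c t m t′ : ℕ}
         (c≡ : c ≡ 15 * u) (t≡ : t ≡ 4 * u) (m≡ : m ≡ 8 * (u * u) + 1) (t′≡ : t′ ≡ 4 * m) where
  open ℕₚ.≤-Reasoning
  open +-*-Solver

  toft₅-order : (c + (t + 0) + c * (t * 1)) + ((t′ + 0) + t′ * 1) ≡ 124 * (u * u) + (19 * u + 8)
  toft₅-order rewrite c≡ | t≡ | t′≡ | m≡ = solve 1 (λ u →
    (con 15 :* u :+ (con 4 :* u :+ con 0) :+ con 15 :* u :* (con 4 :* u :* con 1))
    :+ ((con 4 :* (con 8 :* (u :* u) :+ con 1) :+ con 0) :+ con 4 :* (con 8 :* (u :* u) :+ con 1) :* con 1)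
    := con 124 :* (u :* u) :+ (con 19 :* u :+ con 8)) refl u

  toft₅-size : ∀ {e S} → m * m ≤ e → c * (t * 1) * (t′ * 1) + e ≤ S →
               4 * (124 * (u * u) * (124 * (u * u))) ≤ 31 * S
  toft₅-size {e} {S} m²≤e ≤S = begin
    4 * (124 * (u * u) * (124 * (u * u)))
      -- The surplus comes from the `+ 1` in `m`; the leading terms agree exactly.
      ≤⟨ ℕₚ.m≤m+n _ (31 * (256 * (u * u) + 1)) ⟩
    4 * (124 * (u * u) * (124 * (u * u))) + 31 * (256 * (u * u) + 1)
      ≡⟨ identity ⟩
    31 * (c * (t * 1) * (t′ * 1) + m * m)
      ≤⟨ ℕₚ.*-monoʳ-≤ 31 (ℕₚ.≤-trans (ℕₚ.+-monoʳ-≤ _ m²≤e) ≤S) ⟩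
    31 * S ∎
    where
    identity : 4 * (124 * (u * u) * (124 * (u * u))) + 31 * (256 * (u * u) + 1) ≡ 31 * (c * (t * 1) * (t′ * 1) + m * m)
    identity rewrite c≡ | t≡ | t′≡ | m≡ = solve 1 (λ u →
      con 4 :* (con 124 :* (u :* u) :* (con 124 :* (u :* u))) :+ con 31 :* (con 256 :* (u :* u) :+ con 1)
      := con 31 :* (con 15 :* u :* (con 4 :* u :* con 1) :* (con 4 :* (con 8 :* (u :* u) :+ con 1) :* con 1)
         :+ (con 8 :* (u :* u) :+ con 1) :* (con 8 :* (u :* u) :+ con 1))) refl u

  toft₅-few : 4 * (4 * D * (19 * u + 8)) ≤ 124 * (u * u)
  toft₅-few = begin
    4 * (4 * D * (19 * u + 8))      ≤⟨ ℕₚ.*-monoʳ-≤ 4 (ℕₚ.*-mono-≤ 4D≤u (ℕₚ.+-monoʳ-≤ (19 * u) 8≤2u)) ⟩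
    4 * (u * (19 * u + 2 * u))      ≤⟨ ℕₚ.m≤m+n _ (40 * (u * u)) ⟩
    4 * (u * (19 * u + 2 * u)) + 40 * (u * u)
      ≡⟨ solve 1 (λ u → con 4 :* (u :* (con 19 :* u :+ con 2 :* u)) :+ con 40 :* (u :* u) := con 124 :* (u :* u)) refl u ⟩
    124 * (u * u)                   ∎
    where
    8≤2u : 8 ≤ 2 * u
    8≤2u = ℕₚ.≤-trans (ℕₚ.m≤n+m 8 2) (ℕₚ.*-monoʳ-≤ 2 5≤u)

  u≤124u² : u ≤ 124 * (u * u)
  u≤124u² = begin
    u             ≡⟨ ℕₚ.*-identityʳ u ⟨
    u * 1         ≤⟨ ℕₚ.*-monoʳ-≤ u (ℕₚ.≤-trans (s≤s z≤n) 5≤u) ⟩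
    u * u         ≤⟨ ℕₚ.m≤n*m (u * u) 124 ⟩
    124 * (u * u) ∎

  toft₅-dense : ∀ {n e S} → n ≡ (c + (t + 0) + c * (t * 1)) + ((t′ + 0) + t′ * 1) →
                m * m ≤ e → c * (t * 1) * (t′ * 1) + e ≤ S →
                u ≤ n × 4 * D * (n * n) < 31 * D * S + n * n
  toft₅-dense {n} n≡ m²≤e ≤S =
    subst (u ≤_) (sym n≡′) (ℕₚ.≤-trans u≤124u² (ℕₚ.m≤m+n _ _)) ,
    dense-bound 4 31 D (124 * (u * u)) (19 * u + 8) n≡′ (toft₅-size m²≤e ≤S) toft₅-few
      (ℕₚ.≤-trans (ℕₚ.≤-trans (s≤s z≤n) 5≤u) u≤124u²)
    where
    n≡′ : n ≡ 124 * (u * u) + (19 * u + 8)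
    n≡′ = trans n≡ toft₅-order

-- With `x * t′` hubs on the first side and `t′` on the second, the density tends to (x + 1/16) / (x
-- + 2)², which is maximal at x = 15/8 with value 4/31. The orders `15 * u`, `4 * u` and
-- `4 * (8 * (u * u) + 1)` realise this ratio up to lower terms; `u` is odd and 1 is added because
-- cycle lengths must be odd.
dense₅ : Dense 4 4 31
dense₅ D n _ = G , ℕₚ.≤-trans n≤u (proj₁ bounds) , proj₂ bounds
  where
  open +-*-Solver
  p = n + 2 * D
  u = 5 + 2 * p
  C = oddCycle (35 + 15 * p)
  T,_ = toft₄ p
  T′,_ = toft₄ (98 + 80 * p + 16 * (p * p))
  T = proj₁ T,_
  T′ = proj₁ T′,_

  G : Crit 4
  G = Toft.toft (C ∷ T ∷ []) (T′ ∷ [])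

  4D≤u : 4 * D ≤ u
  4D≤u = ℕₚ.≤-trans (ℕₚ.m≤n+m (4 * D) (5 + 2 * n)) (ℕₚ.≤-reflexive
    (solve 2 (λ n D → con 5 :+ con 2 :* n :+ con 4 :* D := con 5 :+ con 2 :* (n :+ con 2 :* D)) refl n D))

  n≤u : n ≤ u
  n≤u = ℕₚ.≤-trans (ℕₚ.m≤m+n n (2 * D)) (n≤5+2n p)

  bounds : u ≤ ∣V∣ G × 4 * D * (∣V∣ G * ∣V∣ G) < 31 * D * size (graph G) + ∣V∣ G * ∣V∣ G
  bounds = toft₅-dense D u (ℕₚ.m≤m+n 5 (2 * p)) 4D≤u
    (solve 1 (λ p → con 5 :+ con 2 :* (con 35 :+ con 15 :* p) := con 15 :* (con 5 :+ con 2 :* p)) refl p)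
    (proj₁ (proj₂ T,_))
    (solve 1 (λ p → con 5 :+ con 2 :* (con 98 :+ con 80 :* p :+ con 16 :* (p :* p))
                 := con 8 :* ((con 5 :+ con 2 :* p) :* (con 5 :+ con 2 :* p)) :+ con 1) refl p)
    (proj₁ (proj₂ T′,_)) (Toft.order-toft (C ∷ T ∷ []) (T′ ∷ [])) (proj₂ (proj₂ T′,_)) (toft-size (C ∷ T ∷ []) T′ [])

-- Chromatic number at least 6

-- In such a family, multiplying the parameter by a constant multiplies the order by it up to a
-- bounded error, which is what balancing the hub sets requires.
Progression : ℕ → Set₁
Progression o = Σ[ α ∈ ℕ ] Σ[ β ∈ ℕ ] (∀ p → Σ[ A ∈ Crit o ] ∣V∣ A ≡ α + suc β * p)

member : Progression o → Crit o
member (_ , _ , A) = proj₁ (A 0)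

chain : ∀ o j → (∀ {i} → i < j → Crit (o + i)) → Chain o j
chain o zero    A = []
chain o (suc j) A = subst Crit (ℕₚ.+-identityʳ o) (A (s≤s z≤n))
                  ∷ chain (suc o) j (λ i<j → subst Crit (ℕₚ.+-suc o _) (A (s≤s i<j)))

-- With one side fixed and a single graph `B` on the other, the order of the join is twice that of
-- `B` plus a constant, so a progression for `B` yields one for the next chromatic number.
progression : ∀ o → Progression (2 + o)
progression = <-rec (λ o → Progression (2 + o)) step
  where
  open +-*-Solver
  step : ∀ o → (∀ {i} → i < o → Progression (2 + i)) → Progression (2 + o)
  step zero    _   = 5 , 1 , λ p → oddCycle p , refl
  step (suc o) rec =
    let α , β , A = rec (ℕₚ.n<1+n o)
        Cs = chain 2 (suc o) (member ∘ rec)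
        K = ∣Base∣ Cs + ∣Hub∣ Cs
    in α + α + K , β + suc β , λ p →
      let B , ∣B∣≡ = A p in
      Toft.toft (B ∷ []) Cs ,
      trans (Toft.order-toft (B ∷ []) Cs) (trans (cong (λ b → b + 0 + b * 1 + K) ∣B∣≡)
        (solve 4 (λ α β p K → let b = α :+ (con 1 :+ β) :* p in
          b :+ con 0 :+ b :* con 1 :+ K
          := α :+ α :+ K :+ (con 1 :+ (β :+ (con 1 :+ β))) :* p) refl α β p K))

-- A chain ending in two graphs that are still to be chosen.
chain-ending : ∀ m o → Σ[ h ∈ ℕ ] Σ[ c ∈ ℕ ] (∀ {n} → n ≡ m + (2 + o) → (M : Crit n) (L : Crit (suc n)) →
  Σ[ Cs ∈ Chain (2 + o) (2 + m) ] (∣Hub∣ Cs ≡ suc h * (∣V∣ M * ∣V∣ L) × ∣Base∣ Cs ≡ c + (∣V∣ M + ∣V∣ L)))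
chain-ending zero o = 0 , 0 , λ { refl M L → M ∷ L ∷ [] ,
  trans (cong (∣V∣ M *_) (ℕₚ.*-identityʳ (∣V∣ L))) (sym (ℕₚ.*-identityˡ _)) ,
  cong (λ k → ∣V∣ M + k) (ℕₚ.+-identityʳ (∣V∣ L)) }
chain-ending (suc m) o with chain-ending m (suc o) | ℕₚ.m≤n⇒∃[o]m+o≡n (order≥1 (member (progression o)))
  where
  order≥1 : (A : Crit (2 + o)) → 1 ≤ ∣V∣ A
  order≥1 A with ∣V∣ A | Crit.point A
  ... | suc _ | _ = s≤s z≤n
-- `h + a * suc h` is the predecessor of `suc a * suc h`; the form `suc h` keeps the fixed factor
-- visibly positive.
... | h , c , rest | a , 1+a≡ = h + a * suc h , suc a + c , λ n≡ M L →
  let Cs , hub≡ , base≡ = rest (trans n≡ (sym (ℕₚ.+-suc m (2 + o)))) M L in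
  member (progression o) ∷ Cs ,
  trans (cong₂ _*_ (sym 1+a≡) hub≡) (sym (ℕₚ.*-assoc (suc a) (suc h) (∣V∣ M * ∣V∣ L))) ,
  trans (cong₂ _+_ (sym 1+a≡) base≡) (sym (ℕₚ.+-assoc (suc a) c (∣V∣ M + ∣V∣ L)))

-- The hub sets have N L and (h + 1) M L elements, where (h + 1) M ≡ N + e with
-- e independent of N, so that they can be made almost equal.
dense₆₊ : ∀ m → Dense (5 + m) 1 4
dense₆₊ m D n 1≤D = G , n≤∣G∣ , dense-bound 1 4 D (2 * (N * L)) E ∣G∣≡ size-bound few
    (ℕₚ.*-mono-≤ (s≤s (z≤n {1})) (ℕₚ.*-mono-≤ 1≤N 1≤L))
  where
  open +-*-Solver
  α = proj₁ (progression (1 + m))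
  β = proj₁ (proj₂ (progression (1 + m)))
  A = proj₂ (proj₂ (progression (1 + m)))
  α′ = proj₁ (progression (2 + m))
  β′ = proj₁ (proj₂ (progression (2 + m)))
  A′ = proj₂ (proj₂ (progression (2 + m)))
  h = proj₁ (chain-ending m 1)
  c = proj₁ (proj₂ (chain-ending m 1))
  e = h * α
  -- `N` must absorb the part of `E` that grows with `L`, and `L`, through `p′`, the part that grows
  -- with `N`. The summand `n` makes the order large.
  p = 4 * (D * (e + c + 2)) + n
  p′ = 8 * D
  M∈ = A p
  N∈ = A (suc h * p)
  L∈ = A′ p′
  M = ∣V∣ (proj₁ M∈)
  N = ∣V∣ (proj₁ N∈)
  L = ∣V∣ (proj₁ L∈)
  As = proj₁ N∈ ∷ proj₁ L∈ ∷ []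
  Cs∈ = proj₂ (proj₂ (chain-ending m 1)) {3 + m} (ℕₚ.+-comm 3 m) (proj₁ M∈) (proj₁ L∈)
  Cs = proj₁ Cs∈

  G : Crit (5 + m)
  G = Toft.toft As Cs

  p≤hp : p ≤ suc h * p
  p≤hp = ℕₚ.m≤m+n p (h * p)

  hM≡ : suc h * M ≡ N + e
  hM≡ = trans (cong (suc h *_) (proj₂ M∈))
    (trans (solve 4 (λ h α β p → (con 1 :+ h) :* (α :+ (con 1 :+ β) :* p)
               := α :+ (con 1 :+ β) :* ((con 1 :+ h) :* p) :+ h :* α) refl h α β p)
      (cong (_+ e) (sym (proj₂ N∈))))

  M≤N : M ≤ N
  M≤N = ℕₚ.≤-trans (ℕₚ.≤-reflexive (proj₂ M∈))
    (ℕₚ.≤-trans (ℕₚ.+-monoʳ-≤ α (ℕₚ.*-monoʳ-≤ (suc β) p≤hp)) (ℕₚ.≤-reflexive (sym (proj₂ N∈))))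

  p≤N : p ≤ N
  p≤N = ℕₚ.≤-trans p≤hp (ℕₚ.≤-trans (ℕₚ.m≤n*m (suc h * p) (suc β))
    (ℕₚ.≤-trans (ℕₚ.m≤n+m _ α) (ℕₚ.≤-reflexive (sym (proj₂ N∈)))))

  8D≤L : 8 * D ≤ L
  8D≤L = ℕₚ.≤-trans (ℕₚ.m≤n*m p′ (suc β′))
    (ℕₚ.≤-trans (ℕₚ.m≤n+m _ α′) (ℕₚ.≤-reflexive (sym (proj₂ L∈))))

  4D[e+c+2]≤N : 4 * (D * (e + c + 2)) ≤ N
  4D[e+c+2]≤N = ℕₚ.≤-trans (ℕₚ.m≤m+n _ n) p≤N

  1≤L : 1 ≤ L
  1≤L = ℕₚ.≤-trans (ℕₚ.*-mono-≤ (s≤s (z≤n {7})) 1≤D) 8D≤L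

  1≤N : 1 ≤ N
  1≤N = ℕₚ.≤-trans (ℕₚ.*-mono-≤ (s≤s (z≤n {3})) (ℕₚ.*-mono-≤ 1≤D (ℕₚ.≤-trans (s≤s z≤n) (ℕₚ.m≤n+m 2 (e + c))))) 4D[e+c+2]≤N

  E : ℕ
  E = N + L + (c + (M + L)) + e * L

  hML≡ : suc h * (M * L) ≡ (N + e) * L
  hML≡ = trans (sym (ℕₚ.*-assoc (suc h) M L)) (cong (_* L) hM≡)

  ∣G∣≡ : ∣V∣ G ≡ 2 * (N * L) + E
  ∣G∣≡ = trans (Toft.order-toft As Cs) (trans (cong₂ (λ b h → (N + (L + 0) + N * (L * 1)) + (b + h))
                  (proj₂ (proj₂ Cs∈)) (trans (proj₁ (proj₂ Cs∈)) hML≡))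
    (solve 5 (λ N L M c e → (N :+ (L :+ con 0) :+ N :* (L :* con 1)) :+ ((c :+ (M :+ L)) :+ (N :+ e) :* L)
      := con 2 :* (N :* L) :+ (N :+ L :+ (c :+ (M :+ L)) :+ e :* L)) refl N L M c e))

  size-bound : 1 * (2 * (N * L) * (2 * (N * L))) ≤ 4 * size (graph G)
  size-bound = begin
    1 * (2 * (N * L) * (2 * (N * L))) ≡⟨ solve 2 (λ N L → con 1 :* (con 2 :* (N :* L) :* (con 2 :* (N :* L)))
                                           := con 4 :* (N :* (L :* con 1) :* (N :* L))) refl N L ⟩
    4 * (N * (L * 1) * (N * L))       ≤⟨ ℕₚ.*-monoʳ-≤ 4 (ℕₚ.≤-trans
      (ℕₚ.*-monoʳ-≤ (N * (L * 1)) (ℕₚ.≤-trans (ℕₚ.*-monoˡ-≤ L (ℕₚ.m≤m+n N e))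
        (ℕₚ.≤-reflexive (sym (trans (proj₁ (proj₂ Cs∈)) hML≡)))))
      (hubs≤size As Cs)) ⟩
    4 * size (graph G)                ∎
    where open ℕₚ.≤-Reasoning

  few : 4 * (1 * D * E) ≤ 2 * (N * L)
  few = begin
    4 * (1 * D * E)
      ≤⟨ ℕₚ.*-monoʳ-≤ 4 (ℕₚ.*-monoʳ-≤ (1 * D) (ℕₚ.+-monoˡ-≤ (e * L)
           (ℕₚ.+-monoʳ-≤ (N + L) (ℕₚ.+-mono-≤ c≤cL (ℕₚ.+-monoˡ-≤ L M≤N))))) ⟩
    4 * (1 * D * (N + L + (c * L + (N + L)) + e * L))
      ≡⟨ solve 5 (λ D N L c e → con 4 :* (con 1 :* D :* (N :+ L :+ (c :* L :+ (N :+ L)) :+ e :* L))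
           := N :* (con 8 :* D) :+ con 4 :* (D :* (e :+ c :+ con 2)) :* L) refl D N L c e ⟩
    N * (8 * D) + 4 * (D * (e + c + 2)) * L
      ≤⟨ ℕₚ.+-mono-≤ (ℕₚ.*-monoʳ-≤ N 8D≤L) (ℕₚ.*-monoˡ-≤ L 4D[e+c+2]≤N) ⟩
    N * L + N * L
      ≡⟨ cong (λ k → N * L + k) (sym (ℕₚ.+-identityʳ (N * L))) ⟩
    2 * (N * L) ∎
    where
    open ℕₚ.≤-Reasoning
    c≤cL : c ≤ c * L
    c≤cL = ℕₚ.≤-trans (ℕₚ.≤-reflexive (sym (ℕₚ.*-identityʳ c))) (ℕₚ.*-monoʳ-≤ c 1≤L)

  n≤∣G∣ : n ≤ ∣V∣ G
  n≤∣G∣ = begin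
    n                  ≤⟨ ℕₚ.m≤n+m n _ ⟩
    p                  ≤⟨ p≤N ⟩
    N                  ≤⟨ ℕₚ.m≤m+n N _ ⟩
    N + L              ≤⟨ ℕₚ.m≤m+n (N + L) _ ⟩
    N + L + (c + (M + L)) ≤⟨ ℕₚ.m≤m+n _ (e * L) ⟩
    E                  ≤⟨ ℕₚ.m≤n+m E (2 * (N * L)) ⟩
    2 * (N * L) + E    ≡⟨ ∣G∣≡ ⟨
    ∣V∣ G              ∎
    where open ℕₚ.≤-Reasoning

-- A positive constant common to all `k` has to lie below the least of the three densities obtained,
-- 1/16.
1/17∈DensityConstants : ∀ k → 4 ≤ k → (+ 1 / 17) ∈ DensityConstants 3 k
1/17∈DensityConstants 4 _ = Dense⇒DensityConstants {r = + 1 / 16} dense₄ refl refl (from-yes (+ 1 / 17 ℚₚ.<? + 1 / 16))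
1/17∈DensityConstants 5 _ = Dense⇒DensityConstants {r = + 4 / 31} dense₅ refl refl (from-yes (+ 1 / 17 ℚₚ.<? + 4 / 31))
1/17∈DensityConstants (suc (suc (suc (suc (suc (suc m)))))) _ =
  Dense⇒DensityConstants {r = + 1 / 4} (dense₆₊ m) refl refl (from-yes (+ 1 / 17 ℚₚ.<? + 1 / 4))
1/17∈DensityConstants 0 ()
1/17∈DensityConstants 1 (s≤s ())
1/17∈DensityConstants 2 (s≤s (s≤s ()))
1/17∈DensityConstants 3 (s≤s (s≤s (s≤s ())))

theorem1 : (Σ[ c ∈ ℚ ] Σ[ F ∈ Pred Graph 0ℓ ]
    (0ℚ ℚ.< c)
    × (∀ G → G ∈ F → TriangleFree G × Critical G × HasDensity> c G)
    × (∀ k → 4 ≤ k → InfinitelyMany (λ G → G ∈ F × HasChromaticNumber G k)))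
    × Sup≥ (DensityConstants 3 4) (+ 1 / 16)
    × Sup≥ (DensityConstants 3 5) (+ 4 / 31)
    × (∀ k → 6 ≤ k → IsSup (DensityConstants 3 k) (+ 1 / 4))
theorem1 =
  ( + 1 / 17
  , (λ G → TriangleFree G × Critical G × HasDensity> (+ 1 / 17) G)
  , from-yes (0ℚ ℚₚ.<? + 1 / 17)
  , (λ G G∈F → G∈F)
  , λ k 4≤k → let G , G∈ , distinct = 1/17∈DensityConstants k 4≤k in
      G
    , (λ i → let critical , og , dense = G∈ i in
        (OddGirth>3⇒TriangleFree (G i) og , (k , critical) , dense) , proj₁ critical)
    , distinct )
  , Dense⇒Sup≥ (+ 1 / 16) dense₄ refl refl
  , Dense⇒Sup≥ (+ 4 / 31) dense₅ refl refl
  , λ k 6≤k → DensityConstants-Sup≤ k , lower k 6≤k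
  where
  lower : ∀ k → 6 ≤ k → Sup≥ (DensityConstants 3 k) (+ 1 / 4)
  lower (suc (suc (suc (suc (suc (suc m)))))) (s≤s (s≤s (s≤s (s≤s (s≤s (s≤s _)))))) =
    Dense⇒Sup≥ (+ 1 / 4) (dense₆₊ m) refl refl
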